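{- Let $d \geq 2$ be an integer, let $\mathbb{F}$ be a field, and let $V$ be a vector space over $\mathbb{F}$ of dimension $d+1$. Let $\Phi = (A; \{E_i\}_{i=0}^d; A^*; \{E^*_i\}_{i=0}^d)$ be a Hessenberg system on $V$. If $\Phi$ is a Tridiagonal Hessenberg system (THS), then $\Phi$ is TD.
   Context: $\mathrm{End}(V)$ is the algebra of $\mathbb{F}$-linear maps $V\to V$. An element of $\mathrm{End}(V)$ is multiplicity-free if it is diagonalizable and every eigenspace has dimension one. For multiplicity-free $A$ with eigenspaces ordered $V_0,\dots,V_d$, the corresponding primitive idempotents are $E_0,\dots,E_d \in \mathrm{End}(V)$, where $E_i$ acts as the identity on $V_i$ and as $0$ on $V_j$ for $j\neq i$. The superscript $*$ in $A^*$, $E_i^*$ is just notation (not an adjoint). A Hessenberg system on $V$ is a sequence $\Phi=(A; \{E_i\}_{i=0}^d; A^*; \{E^*_i\}_{i=0}^d)$ of elements of $\mathrm{End}(V)$ such that: (i) $A$ and $A^*$ are multiplicity-free; (ii) $\{E_i\}_{i=0}^d$ is an ordering of the primitive idempotents of $A$; (iii) $\{E^*_i\}_{i=0}^d$ is an ordering of the primitive idempotents of $A^*$; (iv) for $0\le i,j\le d$, $E_iA^*E_j=0$ if $i-j>1$ and $E_iA^*E_j\neq 0$ if $i-j=1$; (v) for $0\le i,j\le d$, $E^*_iAE^*_j=0$ if $i-j>1$ and $E^*_iAE^*_j\neq 0$ if $i-j=1$. A Hessenberg system $\Phi$ is a Tridiagonal Hessenberg system (THS) if for all $0\le i,j\le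 d$ with $1<j-i$ we have $E_iA^*E_j=0$ and $E^*_iAE^*_j=0$. A Hessenberg system $\Phi$ is TD if there exist scalars $\beta,\gamma,\gamma^*,\varrho,\varrho^*\in\mathbb{F}$ such that $$0=[A, A^2A^*-\beta AA^*A+A^*A^2-\gamma(AA^*+A^*A)-\varrho A^*],$$ $$0=[A^*, A^{*2}A-\beta A^*AA^*+AA^{*2}-\gamma^*(A^*A+AA^*)-\varrho^*A],$$ where $[X,Y]=XY-YX$. -}

module Defs where

open import Level using (Level; _⊔_; suc)
open import Algebra.Bundles using (CommutativeRing)
open import Algebra.Module.Bundles using (LeftModule)
import Algebra.Definitions as AlgebraDefinitions
open import Algebra.Definitions.RawMonoid using (sum)
open import Algebra.Module.Morphism.Structures using (module LeftModuleMorphisms)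
open import Data.Fin.Base using (Fin; toℕ)
open import Data.Nat.Base as ℕ using (ℕ)
open import Data.Product.Base using (Σ-syntax; ∃-syntax; _×_)
open import Data.Unit.Polymorphic.Base using (⊤)
open import Function.Definitions using (Injective)
open import Relation.Binary.PropositionalEquality.Core using (_≡_; _≢_)
open import Relation.Nullary.Negation.Core using (¬_)
import Relation.Binary.Reasoning.Setoid as SetoidReasoning

record Field (c ℓ : Level) : Set (suc (c ⊔ ℓ)) where
  field
    commutativeRing : CommutativeRing c ℓ

  open CommutativeRing commutativeRing public
  open AlgebraDefinitions _≈_ using (Invertible)

  field
    1≉0           : 1# ≉ 0#
    ≉0⇒invertible : ∀ x → x ≉ 0# → Invertible 1# _*_ x

record VectorSpace {c ℓ} (F : Field c ℓ) (m ℓm : Level) : Set (c ⊔ ℓ ⊔ suc (m ⊔ ℓm)) where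
  field
    leftModule : LeftModule (Field.ring F) m ℓm

  open LeftModule leftModule public

module _ {c ℓ m ℓm} {F : Field c ℓ} (V : VectorSpace F m ℓm) where

  private
    module F = Field F
  open VectorSpace V

  Subset : (p : Level) → Set (m ⊔ suc p)
  Subset p = Carrierᴹ → Set p

  linearCombination : ∀ {n} → (Fin n → F.Carrier) → (Fin n → Carrierᴹ) → Carrierᴹ
  linearCombination a b = sum +ᴹ-rawMonoid (λ k → a k *ₗ b k)

  record IsBasisOf {p} (W : Subset p) {n} (b : Fin n → Carrierᴹ)
                   : Set (c ⊔ ℓ ⊔ m ⊔ ℓm ⊔ p) where
    field
      member      : ∀ k → W (b k)
      independent : ∀ a → linearCombination a b ≈ᴹ 0ᴹ → ∀ k → a k F.≈ F.0#
      spanning    : ∀ v → W v → ∃[ a ] v ≈ᴹ linearCombination a b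

  wholeSpace : Subset ℓm
  wholeSpace _ = ⊤

  SubspaceHasDimension : ∀ {p} → Subset p → ℕ → Set (c ⊔ ℓ ⊔ m ⊔ ℓm ⊔ p)
  SubspaceHasDimension W n = Σ[ b ∈ (Fin n → Carrierᴹ) ] IsBasisOf W b

  HasDimension : ℕ → Set (c ⊔ ℓ ⊔ m ⊔ ℓm)
  HasDimension = SubspaceHasDimension wholeSpace

  open LeftModuleMorphisms rawLeftModule rawLeftModule using (IsLeftModuleHomomorphism)

  record End : Set (c ⊔ m ⊔ ℓm) where
    field
      apply    : Carrierᴹ → Carrierᴹ
      isLinear : IsLeftModuleHomomorphism apply

    open IsLeftModuleHomomorphism isLinear public

module _ {c ℓ m ℓm} {F : Field c ℓ} {V : VectorSpace F m ℓm} where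

  private
    module F = Field F
  open VectorSpace V
  open End using (apply)

  private
    mkEnd : (f : Carrierᴹ → Carrierᴹ) →
            (∀ {x y} → x ≈ᴹ y → f x ≈ᴹ f y) →
            (∀ x y → f (x +ᴹ y) ≈ᴹ f x +ᴹ f y) →
            (∀ a x → f (a *ₗ x) ≈ᴹ a *ₗ f x) →
            End V
    mkEnd f f-cong f-+ f-* = record
      { apply    = f
      ; isLinear = record
        { +ᴹ-isGroupHomomorphism = record
          { isMonoidHomomorphism = record
            { isMagmaHomomorphism = record
              { isRelHomomorphism = record { cong = f-cong }
              ; homo              = f-+
              }
            ; ε-homo = f-0
            }
          ; ⁻¹-homo = λ x → uniqueʳ‿-ᴹ (f x) (f (-ᴹ x))
              (≈ᴹ-trans (≈ᴹ-sym (f-+ x (-ᴹ x)))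
              (≈ᴹ-trans (f-cong (-ᴹ‿inverseʳ x)) f-0))
          }
        ; *ₗ-homo = f-*
        }
      }
      where
      f-0 : f 0ᴹ ≈ᴹ 0ᴹ
      f-0 = ≈ᴹ-trans (f-cong (≈ᴹ-sym (*ₗ-zeroˡ 0ᴹ)))
            (≈ᴹ-trans (f-* F.0# 0ᴹ) (*ₗ-zeroˡ (f 0ᴹ)))

    interchange : ∀ w x y z → (w +ᴹ x) +ᴹ (y +ᴹ z) ≈ᴹ (w +ᴹ y) +ᴹ (x +ᴹ z)
    interchange w x y z = begin
      (w +ᴹ x) +ᴹ (y +ᴹ z) ≈⟨ +ᴹ-assoc w x (y +ᴹ z) ⟩
      w +ᴹ (x +ᴹ (y +ᴹ z)) ≈⟨ +ᴹ-congˡ (≈ᴹ-sym (+ᴹ-assoc x y z)) ⟩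
      w +ᴹ ((x +ᴹ y) +ᴹ z) ≈⟨ +ᴹ-congˡ (+ᴹ-congʳ (+ᴹ-comm x y)) ⟩
      w +ᴹ ((y +ᴹ x) +ᴹ z) ≈⟨ +ᴹ-congˡ (+ᴹ-assoc y x z) ⟩
      w +ᴹ (y +ᴹ (x +ᴹ z)) ≈⟨ +ᴹ-assoc w y (x +ᴹ z) ⟨
      (w +ᴹ y) +ᴹ (x +ᴹ z) ∎
      where open SetoidReasoning ≈ᴹ-setoid

  infix  4 _≈ₑ_ _≉ₑ_
  infixl 6 _+ₑ_ _-ₑ_
  infixr 7 _·ₑ_
  infixl 8 _∘ₑ_

  _≈ₑ_ : End V → End V → Set (m ⊔ ℓm)
  X ≈ₑ Y = ∀ v → apply X v ≈ᴹ apply Y v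

  _≉ₑ_ : End V → End V → Set (m ⊔ ℓm)
  X ≉ₑ Y = ¬ (X ≈ₑ Y)

  0ₑ : End V
  0ₑ = mkEnd (λ _ → 0ᴹ) (λ _ → ≈ᴹ-refl)
    (λ _ _ → ≈ᴹ-sym (+ᴹ-identityˡ 0ᴹ)) (λ a _ → ≈ᴹ-sym (*ₗ-zeroʳ a))

  _∘ₑ_ : End V → End V → End V
  X ∘ₑ Y = mkEnd (λ v → apply X (apply Y v))
    (λ p → X.⟦⟧-cong (Y.⟦⟧-cong p))
    (λ u v → ≈ᴹ-trans (X.⟦⟧-cong (Y.+ᴹ-homo u v)) (X.+ᴹ-homo _ _))
    (λ a v → ≈ᴹ-trans (X.⟦⟧-cong (Y.*ₗ-homo a v)) (X.*ₗ-homo a _))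
    where
    module X = End X
    module Y = End Y

  _+ₑ_ : End V → End V → End V
  X +ₑ Y = mkEnd (λ v → apply X v +ᴹ apply Y v)
    (λ p → +ᴹ-cong (X.⟦⟧-cong p) (Y.⟦⟧-cong p))
    (λ u v → ≈ᴹ-trans (+ᴹ-cong (X.+ᴹ-homo u v) (Y.+ᴹ-homo u v)) (interchange _ _ _ _))
    (λ a v → ≈ᴹ-trans (+ᴹ-cong (X.*ₗ-homo a v) (Y.*ₗ-homo a v)) (≈ᴹ-sym (*ₗ-distribˡ a _ _)))
    where
    module X = End X
    module Y = End Y

  _·ₑ_ : F.Carrier → End V → End V
  a ·ₑ X = mkEnd (λ v → a *ₗ apply X v)
    (λ p → *ₗ-congˡ (X.⟦⟧-cong p))
    (λ u v → ≈ᴹ-trans (*ₗ-congˡ (X.+ᴹ-homo u v)) (*ₗ-distribˡ a _ _))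
    (λ b v → begin
      a *ₗ apply X (b *ₗ v)   ≈⟨ *ₗ-congˡ (X.*ₗ-homo b v) ⟩
      a *ₗ (b *ₗ apply X v)   ≈⟨ *ₗ-assoc a b _ ⟨
      (a F.* b) *ₗ apply X v  ≈⟨ *ₗ-congʳ (F.*-comm a b) ⟩
      (b F.* a) *ₗ apply X v  ≈⟨ *ₗ-assoc b a _ ⟩
      b *ₗ (a *ₗ apply X v)   ∎)
    where
    module X = End X
    open SetoidReasoning ≈ᴹ-setoid

  _-ₑ_ : End V → End V → End V
  X -ₑ Y = X +ₑ (F.- F.1#) ·ₑ Y

  [_,_] : End V → End V → End V
  [ X , Y ] = X ∘ₑ Y -ₑ Y ∘ₑ X

  Eigenspace : End V → F.Carrier → Subset V ℓm
  Eigenspace A θ v = apply A v ≈ᴹ θ *ₗ v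

  IsEigenvalue : End V → F.Carrier → Set (m ⊔ ℓm)
  IsEigenvalue A θ = ∃[ v ] v ≉ᴹ 0ᴹ × Eigenspace A θ v

  Diagonalizable : End V → Set (c ⊔ ℓ ⊔ m ⊔ ℓm)
  Diagonalizable A = ∃[ n ] Σ[ b ∈ (Fin n → Carrierᴹ) ]
    IsBasisOf V (wholeSpace V) b × (∀ k → ∃[ θ ] Eigenspace A θ (b k))

  MultiplicityFree : End V → Set (c ⊔ ℓ ⊔ m ⊔ ℓm)
  MultiplicityFree A =
    Diagonalizable A ×
    (∀ θ → IsEigenvalue A θ → SubspaceHasDimension V (Eigenspace A θ) 1)

  -- The eigenspaces of A are V₀, V₁, …, with Vᵢ the eigenspace for θ i, each
  -- listed exactly once, and E i is the projection onto Vᵢ along the others.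
  record IsOrderingOfPrimitiveIdempotents (A : End V) {n} (E : Fin n → End V)
                                          : Set (c ⊔ ℓ ⊔ m ⊔ ℓm) where
    field
      θ            : Fin n → F.Carrier
      θ-eigenvalue : ∀ i → IsEigenvalue A (θ i)
      θ-distinct   : Injective _≡_ F._≈_ θ
      θ-complete   : ∀ μ → IsEigenvalue A μ → ∃[ i ] μ F.≈ θ i
      E-identity   : ∀ i v → Eigenspace A (θ i) v → apply (E i) v ≈ᴹ v
      E-zero       : ∀ i j → j ≢ i → ∀ v → Eigenspace A (θ j) v → apply (E i) v ≈ᴹ 0ᴹ

record HessenbergSystem {c ℓ m ℓm} {F : Field c ℓ} (V : VectorSpace F m ℓm) (d : ℕ)
                        : Set (c ⊔ ℓ ⊔ m ⊔ ℓm) where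
  field
    A  : End V
    E  : Fin (ℕ.suc d) → End V
    A* : End V
    E* : Fin (ℕ.suc d) → End V

    A-multiplicityFree  : MultiplicityFree A
    A*-multiplicityFree : MultiplicityFree A*
    E-idempotents       : IsOrderingOfPrimitiveIdempotents A E
    E*-idempotents      : IsOrderingOfPrimitiveIdempotents A* E*

    -- i - j > 1 is written suc j < i, and i - j = 1 is written i ≡ suc j.
    EA*E≈0   : ∀ i j → ℕ.suc (toℕ j) ℕ.< toℕ i → E i ∘ₑ A* ∘ₑ E j ≈ₑ 0ₑ
    EA*E≉0   : ∀ i j → toℕ i ≡ ℕ.suc (toℕ j) → E i ∘ₑ A* ∘ₑ E j ≉ₑ 0ₑ
    E*AE*≈0  : ∀ i j → ℕ.suc (toℕ j) ℕ.< toℕ i → E* i ∘ₑ A ∘ₑ E* j ≈ₑ 0ₑ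
    E*AE*≉0  : ∀ i j → toℕ i ≡ ℕ.suc (toℕ j) → E* i ∘ₑ A ∘ₑ E* j ≉ₑ 0ₑ

module _ {c ℓ m ℓm} {F : Field c ℓ} {V : VectorSpace F m ℓm} {d : ℕ} where

  IsTridiagonal : HessenbergSystem V d → Set (m ⊔ ℓm)
  IsTridiagonal Φ = ∀ i j → ℕ.suc (toℕ i) ℕ.< toℕ j →
    (E i ∘ₑ A* ∘ₑ E j ≈ₑ 0ₑ) × (E* i ∘ₑ A ∘ₑ E* j ≈ₑ 0ₑ)
    where open HessenbergSystem Φ

  IsTD : HessenbergSystem V d → Set (c ⊔ m ⊔ ℓm)
  IsTD Φ = ∃[ β ] ∃[ γ ] ∃[ γ* ] ∃[ ϱ ] ∃[ ϱ* ]
    (0ₑ ≈ₑ [ A , A ∘ₑ A ∘ₑ A* -ₑ β ·ₑ A ∘ₑ A* ∘ₑ A +ₑ A* ∘ₑ A ∘ₑ A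
                 -ₑ γ ·ₑ (A ∘ₑ A* +ₑ A* ∘ₑ A) -ₑ ϱ ·ₑ A* ]) ×
    (0ₑ ≈ₑ [ A* , A* ∘ₑ A* ∘ₑ A -ₑ β ·ₑ A* ∘ₑ A ∘ₑ A* +ₑ A ∘ₑ A* ∘ₑ A*
                  -ₑ γ* ·ₑ (A* ∘ₑ A +ₑ A ∘ₑ A*) -ₑ ϱ* ·ₑ A ])
    where open HessenbergSystem Φ

{-# OPTIONS --safe #-}

-- Choose Z, diagonal in an eigenbasis of A, with [Z , A*] = C, where C = A²A*A - AA*A²; because
-- A* is tridiagonal in that basis, this only prescribes the differences
-- of consecutive eigenvalues of Z. In an eigenbasis of A*, A is tridiagonal with
-- nonzero subdiagonal, so C maps the eigenvector w₀ of A* into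
-- span (w₀ , … , w₃), hence so does Z. Thus Z w₀ = p(A) w₀ with deg p ≤ 3, and
-- Z = p(A) because w₀ generates V under A. The equations p(θᵢ) - p(θᵢ₊₁)
-- = θᵢ θᵢ₊₁ (θᵢ - θᵢ₊₁) give the first TD relation, with β + 1 the inverse of the
-- leading coefficient α₃ of p. Comparing third subdiagonals in [p(A) , A*] = C gives
-- α₃ (θ*ₙ - θ*ₙ₊₃) = θ*ₙ₊₁ - θ*ₙ₊₂, which telescopes to the second relation with
-- the same β. For d = 2 these conditions are void and any β works.

module Submission where

open import Defs
import Algebra.Module.Morphism.Construct.Identity as Identity
open import Algebra.Bundles using (CommutativeRing; RawRing)
open import Algebra.Solver.Ring.AlmostCommutativeRing
  using (_-Raw-AlmostCommutative⟶_; fromCommutativeRing)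
open import Data.Empty using (⊥-elim)
open import Data.Fin.Base as Fin using (Fin; toℕ; punchIn)
import Data.Fin.Properties as Fin
open import Data.Maybe.Base using (Maybe; map)
open import Data.Nat.Base as ℕ using (ℕ; zero; suc; _≤_)
import Data.Nat.Properties as ℕ
open import Data.Product.Base using (_×_; _,_; proj₁; proj₂; ∃-syntax)
open import Function.Base using (_∘_; id)
open import Level using (_⊔_)
open import Relation.Binary.Definitions using (tri<; tri≈; tri>)
open import Relation.Binary.PropositionalEquality.Core as ≡ using (_≡_; _≢_)
import Relation.Binary.Reasoning.Setoid as SetoidReasoning
open import Relation.Nullary.Decidable using (yes; no; dec⇒maybe)
open import Relation.Nullary.Negation.Core using (¬_)

-- A ring solver with integer coefficients for any commutative ring.

module IntegerCoefficientSolver {c ℓ} (R : CommutativeRing c ℓ) where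

  open CommutativeRing R
  open import Algebra.Properties.Ring ring
    using (-‿distribˡ-*; -‿distribʳ-*; -‿involutive; -0#≈0#)
  open import Algebra.Properties.AbelianGroup +-abelianGroup using (⁻¹-∙-comm)
  open import Algebra.Properties.CommutativeSemigroup +-commutativeSemigroup using (interchange)
  open import Algebra.Properties.Semiring.Mult.TCOptimised semiring
    using (×-homo-+; ×1-homo-*) renaming (_×_ to _·_)
  open SetoidReasoning setoid

  -- The pair (a , b) stands for the integer a - b. Only the operations are
  -- needed by the solver, so the pairs need not be quotiented.
  differences : RawRing _ _
  differences = record
    { Carrier = ℕ × ℕ
    ; _≈_     = _≡_
    ; _+_     = λ (a , b) (a′ , b′) → a ℕ.+ a′ , b ℕ.+ b′
    ; _*_     = λ (a , b) (a′ , b′) → a ℕ.* a′ ℕ.+ b ℕ.* b′ , a ℕ.* b′ ℕ.+ b ℕ.* a′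
    ; -_      = λ (a , b) → b , a
    ; 0#      = 0 , 0
    ; 1#      = 1 , 0
    }

  -- The first clause makes con (1 , 0) denote 1# on the nose.
  ⟦_⟧ : ℕ × ℕ → Carrier
  ⟦ a , zero  ⟧ = a · 1#
  ⟦ a , suc b ⟧ = a · 1# - suc b · 1#

  ⟦⟧-difference : ∀ p → ⟦ p ⟧ ≈ proj₁ p · 1# - proj₂ p · 1#
  ⟦⟧-difference (a , zero)  = sym (trans (+-congˡ -0#≈0#) (+-identityʳ _))
  ⟦⟧-difference (a , suc b) = refl

  difference-+ : ∀ x y x′ y′ → (x + x′) - (y + y′) ≈ (x - y) + (x′ - y′)
  difference-+ x y x′ y′ = begin
    (x + x′) - (y + y′)       ≈⟨ +-congˡ (⁻¹-∙-comm y y′) ⟨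
    (x + x′) + (- y + - y′)   ≈⟨ interchange x x′ (- y) (- y′) ⟩
    (x - y) + (x′ - y′)       ∎

  difference-* : ∀ x y x′ y′ → (x * x′ + y * y′) - (x * y′ + y * x′) ≈ (x - y) * (x′ - y′)
  difference-* x y x′ y′ = begin
    (x * x′ + y * y′) - (x * y′ + y * x′)         ≈⟨ difference-+ _ _ _ _ ⟩
    (x * x′ - x * y′) + (y * y′ - y * x′)         ≈⟨ +-cong (+-congˡ (-‿distribʳ-* x y′)) minus ⟩
    (x * x′ + x * - y′) + (- y * x′ + - y * - y′) ≈⟨ +-cong (distribˡ x x′ (- y′)) (distribˡ (- y) x′ (- y′)) ⟨
    x * (x′ - y′) + - y * (x′ - y′)               ≈⟨ distribʳ (x′ - y′) x (- y) ⟨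
    (x - y) * (x′ - y′)                           ∎
    where
    minus : y * y′ - y * x′ ≈ - y * x′ + - y * - y′
    minus = begin
      y * y′ - y * x′           ≈⟨ +-comm _ _ ⟩
      - (y * x′) + y * y′       ≈⟨ +-cong (-‿distribˡ-* y x′) (sym (-‿involutive _)) ⟩
      - y * x′ + - - (y * y′)   ≈⟨ +-congˡ (-‿cong (-‿distribˡ-* y y′)) ⟩
      - y * x′ + - (- y * y′)   ≈⟨ +-congˡ (-‿distribʳ-* (- y) y′) ⟩
      - y * x′ + - y * - y′     ∎

  difference-neg : ∀ x y → y - x ≈ - (x - y)
  difference-neg x y = begin
    y - x         ≈⟨ +-comm y (- x) ⟩
    - x + y       ≈⟨ +-congˡ (-‿involutive y) ⟨
    - x + - - y   ≈⟨ ⁻¹-∙-comm x (- y) ⟩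
    - (x - y)     ∎

  difference-cong : ∀ x y x′ y′ → x + y′ ≈ x′ + y → x - y ≈ x′ - y′
  difference-cong x y x′ y′ eq = begin
    x - y                  ≈⟨ +-identityʳ _ ⟨
    (x - y) + 0#           ≈⟨ +-congˡ (-‿inverseʳ y′) ⟨
    (x - y) + (y′ - y′)    ≈⟨ difference-+ x y y′ y′ ⟨
    (x + y′) - (y + y′)    ≈⟨ +-cong eq (-‿cong (+-comm y y′)) ⟩
    (x′ + y) - (y′ + y)    ≈⟨ difference-+ x′ y′ y y ⟩
    (x′ - y′) + (y - y)    ≈⟨ +-congˡ (-‿inverseʳ y) ⟩
    (x′ - y′) + 0#         ≈⟨ +-identityʳ _ ⟩
    x′ - y′                ∎

  evaluation : differences -Raw-AlmostCommutative⟶ fromCommutativeRing R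
  evaluation = record
    { ⟦_⟧    = ⟦_⟧
    ; +-homo = λ (a , b) (a′ , b′) → begin
        ⟦ a ℕ.+ a′ , b ℕ.+ b′ ⟧
          ≈⟨ ⟦⟧-difference (a ℕ.+ a′ , b ℕ.+ b′) ⟩
        (a ℕ.+ a′) · 1# - (b ℕ.+ b′) · 1#
          ≈⟨ +-cong (×-homo-+ 1# a a′) (-‿cong (×-homo-+ 1# b b′)) ⟩
        (a · 1# + a′ · 1#) - (b · 1# + b′ · 1#)
          ≈⟨ difference-+ _ _ _ _ ⟩
        (a · 1# - b · 1#) + (a′ · 1# - b′ · 1#)
          ≈⟨ +-cong (⟦⟧-difference (a , b)) (⟦⟧-difference (a′ , b′)) ⟨
        ⟦ a , b ⟧ + ⟦ a′ , b′ ⟧ ∎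
    ; *-homo = λ (a , b) (a′ , b′) → begin
        ⟦ a ℕ.* a′ ℕ.+ b ℕ.* b′ , a ℕ.* b′ ℕ.+ b ℕ.* a′ ⟧
          ≈⟨ ⟦⟧-difference (a ℕ.* a′ ℕ.+ b ℕ.* b′ , a ℕ.* b′ ℕ.+ b ℕ.* a′) ⟩
        (a ℕ.* a′ ℕ.+ b ℕ.* b′) · 1# - (a ℕ.* b′ ℕ.+ b ℕ.* a′) · 1#
          ≈⟨ +-cong (bilinear a a′ b b′) (-‿cong (bilinear a b′ b a′)) ⟩
        (a · 1# * a′ · 1# + b · 1# * b′ · 1#) - (a · 1# * b′ · 1# + b · 1# * a′ · 1#)
          ≈⟨ difference-* _ _ _ _ ⟩
        (a · 1# - b · 1#) * (a′ · 1# - b′ · 1#)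
          ≈⟨ *-cong (⟦⟧-difference (a , b)) (⟦⟧-difference (a′ , b′)) ⟨
        ⟦ a , b ⟧ * ⟦ a′ , b′ ⟧ ∎
    ; -‿homo = λ (a , b) → begin
        ⟦ b , a ⟧               ≈⟨ ⟦⟧-difference (b , a) ⟩
        b · 1# - a · 1#         ≈⟨ difference-neg _ _ ⟩
        - (a · 1# - b · 1#)     ≈⟨ -‿cong (⟦⟧-difference (a , b)) ⟨
        - ⟦ a , b ⟧             ∎
    ; 0-homo = refl
    ; 1-homo = refl
    }
    where
    bilinear : ∀ a a′ b b′ →
               (a ℕ.* a′ ℕ.+ b ℕ.* b′) · 1# ≈ a · 1# * a′ · 1# + b · 1# * b′ · 1#
    bilinear a a′ b b′ = trans (×-homo-+ 1# (a ℕ.* a′) (b ℕ.* b′))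
      (+-cong (×1-homo-* a a′) (×1-homo-* b b′))

  -- Equality in `R` need not be decidable, so coefficients are compared as integers, by cross sums
  -- in ℕ. A result `nothing` does not assert inequality: in positive characteristic distinct
  -- integers can have equal images.
  _≟_ : ∀ p q → Maybe (⟦ p ⟧ ≈ ⟦ q ⟧)
  p@(a , b) ≟ q@(a′ , b′) = map equal (dec⇒maybe (a ℕ.+ b′ ℕ.≟ a′ ℕ.+ b))
    where
    equal : a ℕ.+ b′ ≡ a′ ℕ.+ b → ⟦ p ⟧ ≈ ⟦ q ⟧
    equal eq = begin
      ⟦ p ⟧               ≈⟨ ⟦⟧-difference p ⟩
      a · 1# - b · 1#     ≈⟨ difference-cong _ _ _ _ sums ⟩
      a′ · 1# - b′ · 1#   ≈⟨ ⟦⟧-difference q ⟨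
      ⟦ q ⟧               ∎
      where
      sums : a · 1# + b′ · 1# ≈ a′ · 1# + b · 1#
      sums = begin
        a · 1# + b′ · 1#   ≈⟨ ×-homo-+ 1# a b′ ⟨
        (a ℕ.+ b′) · 1#    ≡⟨ ≡.cong (_· 1#) eq ⟩
        (a′ ℕ.+ b) · 1#    ≈⟨ ×-homo-+ 1# a′ b ⟩
        a′ · 1# + b · 1#   ∎

  open import Algebra.Solver.Ring differences (fromCommutativeRing R) evaluation _≟_ public
    using (Polynomial; solve; _:=_; _:+_; _:*_; :-_; _:-_; con)


-- Natural-number indices truncated at d.

-- Indices beyond `d` are sent to `d`. Sequences can thus be indexed by ℕ, and a bound `n ≤ d` is
-- asked for only where the value matters.
clamp : ∀ d → ℕ → Fin (suc d)
clamp d       zero    = Fin.zero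
clamp zero    (suc n) = Fin.zero
clamp (suc d) (suc n) = Fin.suc (clamp d n)

clamp-toℕ : ∀ {d} (i : Fin (suc d)) → clamp d (toℕ i) ≡ i
clamp-toℕ         Fin.zero    = ≡.refl
clamp-toℕ {suc d} (Fin.suc i) = ≡.cong Fin.suc (clamp-toℕ i)

toℕ-clamp : ∀ {d n} → n ≤ d → toℕ (clamp d n) ≡ n
toℕ-clamp ℕ.z≤n       = ≡.refl
toℕ-clamp (ℕ.s≤s n≤d) = ≡.cong suc (toℕ-clamp n≤d)

toℕ-clamp-≤ : ∀ d n → toℕ (clamp d n) ≤ n
toℕ-clamp-≤ d       zero    = ℕ.z≤n
toℕ-clamp-≤ zero    (suc n) = ℕ.z≤n
toℕ-clamp-≤ (suc d) (suc n) = ℕ.s≤s (toℕ-clamp-≤ d n)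

-- Recurrences and polynomial identities for eigenvalue sequences.

module _ {r ℓ} (R : CommutativeRing r ℓ) where

  open CommutativeRing R
  open IntegerCoefficientSolver R
  open SetoidReasoning setoid

  -- (x - y) tdPolynomial x y is the factor by which the first TD commutator scales
  -- the entry of A* between eigenvectors of A with eigenvalues x and y.
  tdPolynomial : (β γ ϱ x y : Carrier) → Carrier
  tdPolynomial β γ ϱ x y = x * x - β * (x * y) + y * y - γ * (x + y) - ϱ

  -- The recurrence says that f n - β f (n + 1) + f (n + 2) is a constant γ, and
  -- tdPolynomial β γ 0 (f (n + 1)) (f (n + 2)) - tdPolynomial β γ 0 (f n) (f (n + 1))
  -- = (f (n + 2) - f n) (f n - β f (n + 1) + f (n + 2) - γ).
  recurrence⇒tdPolynomial : ∀ {d} (θ : Fin (suc d) → Carrier) β →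
    (∀ n → 3 ℕ.+ n ≤ d → θ (clamp d n) - θ (clamp d (3 ℕ.+ n))
                       ≈ (β + 1#) * (θ (clamp d (1 ℕ.+ n)) - θ (clamp d (2 ℕ.+ n)))) →
    ∃[ γ ] ∃[ ϱ ] (∀ i j → toℕ j ≡ suc (toℕ i) → tdPolynomial β γ ϱ (θ i) (θ j) ≈ 0#)
  recurrence⇒tdPolynomial {d} θ β recurrence = γ , ϱ , λ i j adj →
    ≡.subst₂ (λ i′ j′ → tdPolynomial β γ ϱ (θ i′) (θ j′) ≈ 0#)
      (clamp-toℕ i) (≡.trans (≡.cong (clamp d) (≡.sym adj)) (clamp-toℕ j))
      (vanishes (toℕ i) (≡.subst (_≤ d) adj (Fin.toℕ≤pred[n] j)))
    where
    f : ℕ → Carrier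
    f n = θ (clamp d n)

    -- Both constants are read off at the start of the sequence, so that the base cases of
    -- `constant` and `vanishes` hold by choice: `ϱ` is `tdPolynomial` with ϱ = 0 at `f 0`, `f 1`.
    γ = f 0 - β * f 1 + f 2
    ϱ = f 0 * f 0 - β * (f 0 * f 1) + f 1 * f 1 - γ * (f 0 + f 1)

    constant : ∀ n → 2 ℕ.+ n ≤ d → f n - β * f (1 ℕ.+ n) + f (2 ℕ.+ n) ≈ γ
    constant zero    _   = refl
    constant (suc n) n≤d = begin
      b - β * c + e
        ≈⟨ solve 5 (λ β a b c e →
             b :- β :* c :+ e := (a :- β :* b :+ c) :+ ((β :+ con (1 , 0)) :* (b :- c) :- (a :- e)))
           refl β a b c e ⟩
      (a - β * b + c) + ((β + 1#) * (b - c) - (a - e))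
        ≈⟨ +-cong (constant n (ℕ.<⇒≤ n≤d)) (+-congʳ (sym (recurrence n n≤d))) ⟩
      γ + ((a - e) - (a - e))
        ≈⟨ +-congˡ (-‿inverseʳ _) ⟩
      γ + 0#
        ≈⟨ +-identityʳ γ ⟩
      γ ∎
      where
      a = f n
      b = f (1 ℕ.+ n)
      c = f (2 ℕ.+ n)
      e = f (3 ℕ.+ n)

    vanishes : ∀ n → 1 ℕ.+ n ≤ d → tdPolynomial β γ ϱ (f n) (f (1 ℕ.+ n)) ≈ 0#
    vanishes zero    _   = -‿inverseʳ _
    vanishes (suc n) n≤d = begin
      tdPolynomial β γ ϱ b c
        ≈⟨ solve 6 (λ β γ ϱ a b c →
             b :* b :- β :* (b :* c) :+ c :* c :- γ :* (b :+ c) :- ϱ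
             := (a :* a :- β :* (a :* b) :+ b :* b :- γ :* (a :+ b) :- ϱ)
                :+ (c :- a) :* ((a :- β :* b :+ c) :- γ))
           refl β γ ϱ a b c ⟩
      tdPolynomial β γ ϱ a b + (c - a) * ((a - β * b + c) - γ)
        ≈⟨ +-cong (vanishes n (ℕ.<⇒≤ n≤d)) (*-congˡ (+-congʳ (constant n n≤d))) ⟩
      0# + (c - a) * (γ - γ)
        ≈⟨ +-identityˡ _ ⟩
      (c - a) * (γ - γ)
        ≈⟨ *-congˡ (-‿inverseʳ γ) ⟩
      (c - a) * 0#
        ≈⟨ zeroʳ _ ⟩
      0# ∎
      where
      a = f n
      b = f (1 ℕ.+ n)
      c = f (2 ℕ.+ n)

  -- The form, including `α₀ * 1#`, is the one in which the eigenvalues of `cubicₑ` arise from the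
  -- sum, scalar multiple and product rules for diagonal operators.
  cubic : (α₀ α₁ α₂ α₃ x : Carrier) → Carrier
  cubic α₀ α₁ α₂ α₃ x = α₀ * 1# + α₁ * x + α₂ * (x * x) + α₃ * (x * x * x)

  -- For the cubic p, p(x) - p(y) is (x - y) times α₁ + α₂(x + y) + α₃(x² + xy + y²). Multiplying
  -- the hypothesis by `ι` makes the quadratic part monic, and moving ιxy across gives β = ι - 1, γ
  -- = -ια₂, ϱ = -ια₁. The factor x - y is kept: it occurs in the TD commutator anyway, and a
  -- commutative ring allows no cancellation.
  cubic⇒tdPolynomial : ∀ α₀ α₁ α₂ α₃ ι → ι * α₃ ≈ 1# → ∀ x y →
    cubic α₀ α₁ α₂ α₃ x - cubic α₀ α₁ α₂ α₃ y ≈ x * y * (x - y) →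
    (x - y) * tdPolynomial (ι - 1#) (- (ι * α₂)) (- (ι * α₁)) x y ≈ 0#
  cubic⇒tdPolynomial α₀ α₁ α₂ α₃ ι ια₃≈1 x y difference = begin
    (x - y) * tdPolynomial (ι - 1#) (- (ι * α₂)) (- (ι * α₁)) x y
      ≈⟨ solve 7 (λ α₀ α₁ α₂ α₃ ι x y →
           let p = λ x → α₀ :* con (1 , 0) :+ α₁ :* x :+ α₂ :* (x :* x) :+ α₃ :* (x :* x :* x) in
           (x :- y) :* (x :* x :- (ι :- con (1 , 0)) :* (x :* y) :+ y :* y
                        :- (:- (ι :* α₂)) :* (x :+ y) :- (:- (ι :* α₁)))
           := (con (1 , 0) :- ι :* α₃) :* (x :* x :* x :- y :* y :* y)
              :+ ι :* ((p x :- p y) :- x :* y :* (x :- y)))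
         refl α₀ α₁ α₂ α₃ ι x y ⟩
    (1# - ι * α₃) * (x * x * x - y * y * y)
      + ι * ((cubic α₀ α₁ α₂ α₃ x - cubic α₀ α₁ α₂ α₃ y) - x * y * (x - y))
      ≈⟨ +-cong (*-congʳ (+-congˡ (-‿cong ια₃≈1))) (*-congˡ (+-congʳ difference)) ⟩
    (1# - 1#) * (x * x * x - y * y * y) + ι * (x * y * (x - y) - x * y * (x - y))
      ≈⟨ +-cong (*-congʳ (-‿inverseʳ 1#)) (*-congˡ (-‿inverseʳ _)) ⟩
    0# * (x * x * x - y * y * y) + ι * 0#
      ≈⟨ +-cong (zeroˡ _) (zeroʳ ι) ⟩
    0# + 0#
      ≈⟨ +-identityʳ 0# ⟩
    0# ∎

-- Vector arithmetic, finite sums and subspaces.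

module VectorSpaceProperties {c ℓ m ℓm} {F : Field c ℓ} (V : VectorSpace F m ℓm) where

  open Field F
  open VectorSpace V
  open End using (apply)
  open import Algebra.Properties.CommutativeMonoid.Sum +ᴹ-commutativeMonoid public
    using (sum; sum-remove; sum-cong-≋; sum-replicate-zero)
  open import Algebra.Properties.Ring ring using (-1*x≈-x)
  open SetoidReasoning ≈ᴹ-setoid

  infixl 6 _-ᵛ_

  -- The same expression as in the definition of _-ₑ_.
  _-ᵛ_ : Carrierᴹ → Carrierᴹ → Carrierᴹ
  x -ᵛ y = x +ᴹ (- 1#) *ₗ y

  *ₗ-zero : ∀ {a} x → a ≈ 0# → a *ₗ x ≈ᴹ 0ᴹ
  *ₗ-zero x a≈0 = ≈ᴹ-trans (*ₗ-congʳ a≈0) (*ₗ-zeroˡ x)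

  *ₗ-zero′ : ∀ a {x} → x ≈ᴹ 0ᴹ → a *ₗ x ≈ᴹ 0ᴹ
  *ₗ-zero′ a x≈0 = ≈ᴹ-trans (*ₗ-congˡ x≈0) (*ₗ-zeroʳ a)

  *ₗ-comm : ∀ a b x → a *ₗ (b *ₗ x) ≈ᴹ b *ₗ (a *ₗ x)
  *ₗ-comm a b x = begin
    a *ₗ (b *ₗ x) ≈⟨ *ₗ-assoc a b x ⟨
    (a * b) *ₗ x  ≈⟨ *ₗ-congʳ (*-comm a b) ⟩
    (b * a) *ₗ x  ≈⟨ *ₗ-assoc b a x ⟩
    b *ₗ (a *ₗ x) ∎

  *ₗ-minus : ∀ a b x → (a - b) *ₗ x ≈ᴹ a *ₗ x -ᵛ b *ₗ x
  *ₗ-minus a b x = begin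
    (a - b) *ₗ x               ≈⟨ *ₗ-distribʳ x a (- b) ⟩
    a *ₗ x +ᴹ (- b) *ₗ x       ≈⟨ +ᴹ-congˡ (*ₗ-congʳ (-1*x≈-x b)) ⟨
    a *ₗ x +ᴹ (- 1# * b) *ₗ x  ≈⟨ +ᴹ-congˡ (*ₗ-assoc (- 1#) b x) ⟩
    a *ₗ x -ᵛ b *ₗ x           ∎

  -ᵛ-cong : ∀ {x x′ y y′} → x ≈ᴹ x′ → y ≈ᴹ y′ → x -ᵛ y ≈ᴹ x′ -ᵛ y′
  -ᵛ-cong p q = +ᴹ-cong p (*ₗ-congˡ q)

  -ᵛ-self : ∀ x → x -ᵛ x ≈ᴹ 0ᴹ
  -ᵛ-self x = begin
    x -ᵛ x               ≈⟨ -ᵛ-cong (*ₗ-identityˡ x) (*ₗ-identityˡ x) ⟨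
    1# *ₗ x -ᵛ 1# *ₗ x   ≈⟨ *ₗ-minus 1# 1# x ⟨
    (1# - 1#) *ₗ x       ≈⟨ *ₗ-zero x (-‿inverseʳ 1#) ⟩
    0ᴹ                   ∎

  -ᵛ-cancel : ∀ x y → (x -ᵛ y) +ᴹ y ≈ᴹ x
  -ᵛ-cancel x y = begin
    (x -ᵛ y) +ᴹ y                  ≈⟨ +ᴹ-assoc x _ y ⟩
    x +ᴹ ((- 1#) *ₗ y +ᴹ y)        ≈⟨ +ᴹ-congˡ (+ᴹ-comm _ y) ⟩
    x +ᴹ (y -ᵛ y)                  ≈⟨ +ᴹ-congˡ (-ᵛ-self y) ⟩
    x +ᴹ 0ᴹ                        ≈⟨ +ᴹ-identityʳ x ⟩
    x                              ∎

  -ᵛ≈⇒≈+ : ∀ {x y z} → x -ᵛ y ≈ᴹ z → x ≈ᴹ z +ᴹ y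
  -ᵛ≈⇒≈+ {x} {y} eq = ≈ᴹ-trans (≈ᴹ-sym (-ᵛ-cancel x y)) (+ᴹ-congʳ eq)

  -ᵛ≈0⇒≈ : ∀ {x y} → x -ᵛ y ≈ᴹ 0ᴹ → x ≈ᴹ y
  -ᵛ≈0⇒≈ eq = ≈ᴹ-trans (-ᵛ≈⇒≈+ eq) (+ᴹ-identityˡ _)

  ≈⇒-ᵛ≈0 : ∀ {x y} → x ≈ᴹ y → x -ᵛ y ≈ᴹ 0ᴹ
  ≈⇒-ᵛ≈0 {y = y} eq = ≈ᴹ-trans (-ᵛ-cong eq ≈ᴹ-refl) (-ᵛ-self y)

  invertible-cancel : ∀ {a a⁻¹ x} → a⁻¹ * a ≈ 1# → a *ₗ x ≈ᴹ 0ᴹ → x ≈ᴹ 0ᴹ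
  invertible-cancel {a} {a⁻¹} {x} inv eq = begin
    x                ≈⟨ *ₗ-identityˡ x ⟨
    1# *ₗ x          ≈⟨ *ₗ-congʳ inv ⟨
    (a⁻¹ * a) *ₗ x   ≈⟨ *ₗ-assoc a⁻¹ a x ⟩
    a⁻¹ *ₗ (a *ₗ x)  ≈⟨ *ₗ-zero′ a⁻¹ eq ⟩
    0ᴹ               ∎

  sum-zero : ∀ {n} (t : Fin n → Carrierᴹ) → (∀ i → t i ≈ᴹ 0ᴹ) → sum t ≈ᴹ 0ᴹ
  sum-zero {n} t t≈0 = ≈ᴹ-trans (sum-cong-≋ t≈0) (sum-replicate-zero n)

  sum-single : ∀ {n} (t : Fin n → Carrierᴹ) k → (∀ i → i ≢ k → t i ≈ᴹ 0ᴹ) → sum t ≈ᴹ t k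
  sum-single {suc n} t k t≈0 = begin
    sum t                              ≈⟨ sum-remove t ⟩
    t k +ᴹ sum (λ i → t (punchIn k i)) ≈⟨ +ᴹ-congˡ (sum-zero _ (λ i → t≈0 _ (Fin.punchInᵢ≢i k i))) ⟩
    t k +ᴹ 0ᴹ                          ≈⟨ +ᴹ-identityʳ (t k) ⟩
    t k                                ∎

  apply-sum : ∀ (X : End V) {n} (t : Fin n → Carrierᴹ) → apply X (sum t) ≈ᴹ sum (λ i → apply X (t i))
  apply-sum X {zero}  t = End.0ᴹ-homo X
  apply-sum X {suc n} t = ≈ᴹ-trans (End.+ᴹ-homo X _ _) (+ᴹ-congˡ (apply-sum X (t ∘ Fin.suc)))

  apply-minus : ∀ (X : End V) x y → apply X (x -ᵛ y) ≈ᴹ apply X x -ᵛ apply X y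
  apply-minus X x y = ≈ᴹ-trans (End.+ᴹ-homo X _ _) (+ᴹ-congˡ (End.*ₗ-homo X _ _))

  idₑ : End V
  idₑ = record { apply = id ; isLinear = Identity.isLeftModuleHomomorphism rawLeftModule ≈ᴹ-refl }

  sumₑ : ∀ {n} → (Fin n → End V) → End V
  sumₑ {zero}  X = 0ₑ
  sumₑ {suc n} X = X Fin.zero +ₑ sumₑ (X ∘ Fin.suc)

  apply-sumₑ : ∀ {n} (X : Fin n → End V) v → apply (sumₑ X) v ≈ᴹ sum (λ i → apply (X i) v)
  apply-sumₑ {zero}  X v = ≈ᴹ-refl
  apply-sumₑ {suc n} X v = +ᴹ-congˡ (apply-sumₑ (X ∘ Fin.suc) v)

  independent⇒≉0 : ∀ {p} {W : Subset V p} {k} {b : Fin k → Carrierᴹ} → IsBasisOf V W b → ∀ l → ¬ b l ≈ᴹ 0ᴹ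
  independent⇒≉0 {b = b} basis l bl≈0 = 1≉0 (trans (sym δ-diagonal) (independent δ (sum-zero _ terms) l))
    where
    open IsBasisOf basis
    δ : _ → Carrier
    δ k with k Fin.≟ l
    ... | yes _ = 1#
    ... | no  _ = 0#
    δ-diagonal : δ l ≈ 1#
    δ-diagonal with l Fin.≟ l
    ... | yes _  = refl
    ... | no l≢l = ⊥-elim (l≢l ≡.refl)
    terms : ∀ k → δ k *ₗ b k ≈ᴹ 0ᴹ
    terms k with k Fin.≟ l
    ... | yes ≡.refl = *ₗ-zero′ 1# bl≈0
    ... | no  _      = *ₗ-zeroˡ (b k)

  record IsSubspace {p} (P : Subset V p) : Set (c ⊔ m ⊔ ℓm ⊔ p) where
    field
      resp     : ∀ {x y} → x ≈ᴹ y → P x → P y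
      +-closed : ∀ {x y} → P x → P y → P (x +ᴹ y)
      ·-closed : ∀ a {x} → P x → P (a *ₗ x)

    -- `IsSubspace` has no field for zero, so a member `x` is supplied and the empty sum is obtained
    -- as `0# *ₗ x`.
    sum-closed : ∀ {x} → P x → ∀ {n} (t : Fin n → Carrierᴹ) → (∀ i → P (t i)) → P (sum t)
    sum-closed {x} Px {zero}  t Pt = resp (*ₗ-zeroˡ x) (·-closed 0# Px)
    sum-closed     Px {suc n} t Pt = +-closed (Pt Fin.zero) (sum-closed Px (t ∘ Fin.suc) (Pt ∘ Fin.suc))

    sum-extract : ∀ {n} (t : Fin n → Carrierᴹ) k → P (sum t) → (∀ i → i ≢ k → P (t i)) → P (t k)
    sum-extract {suc n} t k Psum Pt = resp
      (≈ᴹ-trans (-ᵛ-cong (sum-remove t) ≈ᴹ-refl) remainder)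
      (+-closed Psum (·-closed (- 1#) (sum-closed Psum rest (λ i → Pt _ (Fin.punchInᵢ≢i k i)))))
      where
      rest : Fin n → Carrierᴹ
      rest i = t (punchIn k i)
      remainder : (t k +ᴹ sum rest) -ᵛ sum rest ≈ᴹ t k
      remainder = begin
        (t k +ᴹ sum rest) -ᵛ sum rest   ≈⟨ +ᴹ-assoc _ _ _ ⟩
        t k +ᴹ (sum rest -ᵛ sum rest)   ≈⟨ +ᴹ-congˡ (-ᵛ-self _) ⟩
        t k +ᴹ 0ᴹ                       ≈⟨ +ᴹ-identityʳ _ ⟩
        t k                             ∎

-- Spectral calculus of a multiplicity-free operator.

module Spectral {c ℓ m ℓm} {F : Field c ℓ} {V : VectorSpace F m ℓm}
  {n} (A : End V) (E : Fin n → End V)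
  (multiplicityFree : MultiplicityFree A) (E-idempotents : IsOrderingOfPrimitiveIdempotents A E) where

  open Field F
  open VectorSpace V
  open VectorSpaceProperties V
  open End using (apply)
  open IsOrderingOfPrimitiveIdempotents E-idempotents public
  open SetoidReasoning ≈ᴹ-setoid

  Eigen : Fin n → Carrierᴹ → Set ℓm
  Eigen j = Eigenspace A (θ j)

  -- Diagonalizability provides a spanning family of eigenvectors. Being part of a basis they are
  -- nonzero, so `θ-complete` assigns each of them to some `θ j`, where the two maps agree.
  eigen-ext : ∀ (X Y : End V) → (∀ j v → Eigen j v → apply X v ≈ᴹ apply Y v) → X ≈ₑ Y
  eigen-ext X Y agree v = begin
    apply X v                           ≈⟨ End.⟦⟧-cong X v≈ ⟩
    apply X (linearCombination V a b)   ≈⟨ apply-sum X (λ k → a k *ₗ b k) ⟩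
    sum (λ k → apply X (a k *ₗ b k))    ≈⟨ sum-cong-≋ agree-b ⟩
    sum (λ k → apply Y (a k *ₗ b k))    ≈⟨ apply-sum Y (λ k → a k *ₗ b k) ⟨
    apply Y (linearCombination V a b)   ≈⟨ End.⟦⟧-cong Y v≈ ⟨
    apply Y v                           ∎
    where
    b     = proj₁ (proj₂ (proj₁ multiplicityFree))
    basis = proj₁ (proj₂ (proj₂ (proj₁ multiplicityFree)))
    eigen = proj₂ (proj₂ (proj₂ (proj₁ multiplicityFree)))
    a     = proj₁ (IsBasisOf.spanning basis v _)
    v≈    = proj₂ (IsBasisOf.spanning basis v _)
    agree-b : ∀ k → apply X (a k *ₗ b k) ≈ᴹ apply Y (a k *ₗ b k)
    agree-b k with eigen k
    ... | μ , Ab≈μb with θ-complete μ (b k , independent⇒≉0 basis k , Ab≈μb)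
    ... | j , μ≈θ = begin
      apply X (a k *ₗ b k) ≈⟨ End.*ₗ-homo X _ _ ⟩
      a k *ₗ apply X (b k) ≈⟨ *ₗ-congˡ (agree j (b k) (≈ᴹ-trans Ab≈μb (*ₗ-congʳ μ≈θ))) ⟩
      a k *ₗ apply Y (b k) ≈⟨ End.*ₗ-homo Y _ _ ⟨
      apply Y (a k *ₗ b k) ∎

  E∘A : ∀ i v → apply (E i) (apply A v) ≈ᴹ θ i *ₗ apply (E i) v
  E∘A i = eigen-ext (E i ∘ₑ A) (θ i ·ₑ E i) agree
    where
    agree : ∀ j v → Eigen j v → apply (E i) (apply A v) ≈ᴹ θ i *ₗ apply (E i) v
    agree j v eig with j Fin.≟ i
    ... | yes ≡.refl = ≈ᴹ-trans (End.⟦⟧-cong (E i) eig) (End.*ₗ-homo (E i) _ _)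
    ... | no  j≢i    = begin
      apply (E i) (apply A v)   ≈⟨ End.⟦⟧-cong (E i) eig ⟩
      apply (E i) (θ j *ₗ v)    ≈⟨ End.*ₗ-homo (E i) _ _ ⟩
      θ j *ₗ apply (E i) v      ≈⟨ *ₗ-zero′ _ (E-zero i j j≢i v eig) ⟩
      0ᴹ                        ≈⟨ *ₗ-zero′ _ (E-zero i j j≢i v eig) ⟨
      θ i *ₗ apply (E i) v      ∎

  E-eigen : ∀ i v → Eigen i (apply (E i) v)
  E-eigen i = eigen-ext (A ∘ₑ E i) (θ i ·ₑ E i) agree
    where
    agree : ∀ j v → Eigen j v → Eigen i (apply (E i) v)
    agree j v eig with j Fin.≟ i
    ... | yes ≡.refl = begin
      apply A (apply (E i) v)   ≈⟨ End.⟦⟧-cong A (E-identity i v eig) ⟩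
      apply A v                 ≈⟨ eig ⟩
      θ i *ₗ v                  ≈⟨ *ₗ-congˡ (E-identity i v eig) ⟨
      θ i *ₗ apply (E i) v      ∎
    ... | no  j≢i    = begin
      apply A (apply (E i) v)   ≈⟨ End.⟦⟧-cong A (E-zero i j j≢i v eig) ⟩
      apply A 0ᴹ                ≈⟨ End.0ᴹ-homo A ⟩
      0ᴹ                        ≈⟨ *ₗ-zero′ _ (E-zero i j j≢i v eig) ⟨
      θ i *ₗ apply (E i) v      ∎

  resolution : ∀ v → sum (λ i → apply (E i) v) ≈ᴹ v
  resolution v = ≈ᴹ-trans (≈ᴹ-sym (apply-sumₑ E v)) (eigen-ext (sumₑ E) idₑ agree v)
    where
    agree : ∀ j v → Eigen j v → apply (sumₑ E) v ≈ᴹ v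
    agree j v eig = begin
      apply (sumₑ E) v             ≈⟨ apply-sumₑ E v ⟩
      sum (λ i → apply (E i) v)    ≈⟨ sum-single _ j (λ i i≢j → E-zero i j (i≢j ∘ ≡.sym) v eig) ⟩
      apply (E j) v                ≈⟨ E-identity j v eig ⟩
      v                            ∎

  component-ext : ∀ {x y} → (∀ i → apply (E i) x ≈ᴹ apply (E i) y) → x ≈ᴹ y
  component-ext eq = ≈ᴹ-trans (≈ᴹ-sym (resolution _)) (≈ᴹ-trans (sum-cong-≋ eq) (resolution _))

  eigenline : ∀ i → SubspaceHasDimension V (Eigen i) 1
  eigenline i = proj₂ multiplicityFree (θ i) (θ-eigenvalue i)

  eigenvector : Fin n → Carrierᴹ
  eigenvector i = proj₁ (eigenline i) Fin.zero

  eigenvector-eigen : ∀ i → Eigen i (eigenvector i)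
  eigenvector-eigen i = IsBasisOf.member (proj₂ (eigenline i)) Fin.zero

  eigenvector-spans : ∀ i v → Eigen i v → ∃[ a ] v ≈ᴹ a *ₗ eigenvector i
  eigenvector-spans i v eig with IsBasisOf.spanning (proj₂ (eigenline i)) v eig
  ... | a , v≈ = a Fin.zero , ≈ᴹ-trans v≈ (+ᴹ-identityʳ _)

  eigenvector-independent : ∀ i a → a *ₗ eigenvector i ≈ᴹ 0ᴹ → a ≈ 0#
  eigenvector-independent i a a≈0 = IsBasisOf.independent (proj₂ (eigenline i)) (λ _ → a)
    (≈ᴹ-trans (+ᴹ-identityʳ _) a≈0) Fin.zero

  θ-difference-invertible : ∀ {i j} → i ≢ j → ∃[ a⁻¹ ] a⁻¹ * (θ i - θ j) ≈ 1#
  θ-difference-invertible {i} {j} i≢j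
    with ≉0⇒invertible (θ i - θ j) (λ eq → i≢j (θ-distinct (x∙y⁻¹≈ε⇒x≈y _ _ eq)))
    where open import Algebra.Properties.Group +-group using (x∙y⁻¹≈ε⇒x≈y)
  ... | a⁻¹ , inverse , _ = a⁻¹ , inverse

  -- Diagonality in an eigenbasis of `A`, expressed as `E i ∘ₑ Y = y i ·ₑ E i`. This needs no chosen
  -- basis, and products compose directly on the left of a vector.
  record Diagonal (Y : End V) (y : Fin n → Carrier) : Set (m ⊔ ℓm) where
    constructor diagonal
    field
      component : ∀ i v → apply (E i) (apply Y v) ≈ᴹ y i *ₗ apply (E i) v

    eigenvalue : ∀ j v → Eigen j v → apply Y v ≈ᴹ y j *ₗ v
    eigenvalue j v eig = component-ext pointwise
      where
      pointwise : ∀ i → apply (E i) (apply Y v) ≈ᴹ apply (E i) (y j *ₗ v)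
      pointwise i with j Fin.≟ i
      ... | yes ≡.refl = ≈ᴹ-trans (component i v) (≈ᴹ-sym (End.*ₗ-homo (E i) _ _))
      ... | no  j≢i    = begin
        apply (E i) (apply Y v)   ≈⟨ component i v ⟩
        y i *ₗ apply (E i) v      ≈⟨ *ₗ-zero′ _ (E-zero i j j≢i v eig) ⟩
        0ᴹ                        ≈⟨ *ₗ-zero′ _ (E-zero i j j≢i v eig) ⟨
        y j *ₗ apply (E i) v      ≈⟨ End.*ₗ-homo (E i) _ _ ⟨
        apply (E i) (y j *ₗ v)    ∎

    preserves-eigen : ∀ j v → Eigen j v → Eigen j (apply Y v)
    preserves-eigen j v eig = begin
      apply A (apply Y v)   ≈⟨ End.⟦⟧-cong A (eigenvalue j v eig) ⟩
      apply A (y j *ₗ v)    ≈⟨ End.*ₗ-homo A _ _ ⟩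
      y j *ₗ apply A v      ≈⟨ *ₗ-congˡ eig ⟩
      y j *ₗ (θ j *ₗ v)     ≈⟨ *ₗ-comm _ _ _ ⟩
      θ j *ₗ (y j *ₗ v)     ≈⟨ *ₗ-congˡ (eigenvalue j v eig) ⟨
      θ j *ₗ apply Y v      ∎

  diagonal-id : Diagonal idₑ (λ _ → 1#)
  diagonal-id = diagonal λ i v → ≈ᴹ-sym (*ₗ-identityˡ _)

  diagonal-A : Diagonal A θ
  diagonal-A = diagonal E∘A

  diagonal-∘ : ∀ {X Y x y} → Diagonal X x → Diagonal Y y → Diagonal (X ∘ₑ Y) (λ i → x i * y i)
  diagonal-∘ (diagonal X) (diagonal Y) = diagonal λ i v →
    ≈ᴹ-trans (X i _) (≈ᴹ-trans (*ₗ-congˡ (Y i v)) (≈ᴹ-sym (*ₗ-assoc _ _ _)))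

  diagonal-+ : ∀ {X Y x y} → Diagonal X x → Diagonal Y y → Diagonal (X +ₑ Y) (λ i → x i + y i)
  diagonal-+ (diagonal X) (diagonal Y) = diagonal λ i v →
    ≈ᴹ-trans (End.+ᴹ-homo (E i) _ _) (≈ᴹ-trans (+ᴹ-cong (X i v) (Y i v)) (≈ᴹ-sym (*ₗ-distribʳ _ _ _)))

  diagonal-· : ∀ a {X x} → Diagonal X x → Diagonal (a ·ₑ X) (λ i → a * x i)
  diagonal-· a (diagonal X) = diagonal λ i v →
    ≈ᴹ-trans (End.*ₗ-homo (E i) _ _) (≈ᴹ-trans (*ₗ-congˡ (X i v)) (≈ᴹ-sym (*ₗ-assoc _ _ _)))

  withEigenvalues : (Fin n → Carrier) → End V
  withEigenvalues z = sumₑ (λ k → z k ·ₑ E k)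

  diagonal-withEigenvalues : ∀ z → Diagonal (withEigenvalues z) z
  diagonal-withEigenvalues z = diagonal λ i v → begin
    apply (E i) (apply (withEigenvalues z) v)
      ≈⟨ End.⟦⟧-cong (E i) (apply-sumₑ (λ k → z k ·ₑ E k) v) ⟩
    apply (E i) (sum (λ k → z k *ₗ apply (E k) v))
      ≈⟨ apply-sum (E i) (λ k → z k *ₗ apply (E k) v) ⟩
    sum (λ k → apply (E i) (z k *ₗ apply (E k) v))
      ≈⟨ sum-single _ i (λ k k≢i → ≈ᴹ-trans (End.*ₗ-homo (E i) _ _) (*ₗ-zero′ _ (E-zero i k k≢i _ (E-eigen k v)))) ⟩
    apply (E i) (z i *ₗ apply (E i) v)
      ≈⟨ End.*ₗ-homo (E i) _ _ ⟩
    z i *ₗ apply (E i) (apply (E i) v)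
      ≈⟨ *ₗ-congˡ (E-identity i _ (E-eigen i v)) ⟩
    z i *ₗ apply (E i) v ∎

  -- Entrywise multiples of `A*` in an eigenbasis of `A`.

  module _ (A* : End V) where

    -- Up to scaling, the (i, j) matrix entry of X in an eigenbasis of A is
    -- c i j times that of A*.
    record SchurMultiple (X : End V) (c : Fin n → Fin n → Carrier) : Set (m ⊔ ℓm) where
      constructor schurMultiple
      field
        entry : ∀ i j v → Eigen j v → apply (E i) (apply X v) ≈ᴹ c i j *ₗ apply (E i) (apply A* v)

    schur-A* : SchurMultiple A* (λ _ _ → 1#)
    schur-A* = schurMultiple λ i j v eig → ≈ᴹ-sym (*ₗ-identityˡ _)

    schur-∘ˡ : ∀ {X Y c y} → Diagonal Y y → SchurMultiple X c → SchurMultiple (Y ∘ₑ X) (λ i j → y i * c i j)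
    schur-∘ˡ (diagonal Y) (schurMultiple X) = schurMultiple λ i j v eig →
      ≈ᴹ-trans (Y i _) (≈ᴹ-trans (*ₗ-congˡ (X i j v eig)) (≈ᴹ-sym (*ₗ-assoc _ _ _)))

    schur-∘ʳ : ∀ {X Y c y} → SchurMultiple X c → Diagonal Y y → SchurMultiple (X ∘ₑ Y) (λ i j → c i j * y j)
    schur-∘ʳ {X} {Y} {c} {y} (schurMultiple entry) D = schurMultiple λ i j v eig → begin
      apply (E i) (apply X (apply Y v))           ≈⟨ entry i j _ (D.preserves-eigen j v eig) ⟩
      c i j *ₗ apply (E i) (apply A* (apply Y v)) ≈⟨ *ₗ-congˡ (End.⟦⟧-cong (E i ∘ₑ A*) (D.eigenvalue j v eig)) ⟩
      c i j *ₗ apply (E i) (apply A* (y j *ₗ v))  ≈⟨ *ₗ-congˡ (End.*ₗ-homo (E i ∘ₑ A*) _ _) ⟩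
      c i j *ₗ (y j *ₗ apply (E i) (apply A* v))  ≈⟨ *ₗ-assoc _ _ _ ⟨
      (c i j * y j) *ₗ apply (E i) (apply A* v)   ∎
      where module D = Diagonal D

    schur-+ : ∀ {X Y c e} → SchurMultiple X c → SchurMultiple Y e → SchurMultiple (X +ₑ Y) (λ i j → c i j + e i j)
    schur-+ (schurMultiple X) (schurMultiple Y) = schurMultiple λ i j v eig →
      ≈ᴹ-trans (End.+ᴹ-homo (E i) _ _)
      (≈ᴹ-trans (+ᴹ-cong (X i j v eig) (Y i j v eig)) (≈ᴹ-sym (*ₗ-distribʳ _ _ _)))

    schur-· : ∀ a {X c} → SchurMultiple X c → SchurMultiple (a ·ₑ X) (λ i j → a * c i j)
    schur-· a (schurMultiple X) = schurMultiple λ i j v eig →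
      ≈ᴹ-trans (End.*ₗ-homo (E i) _ _) (≈ᴹ-trans (*ₗ-congˡ (X i j v eig)) (≈ᴹ-sym (*ₗ-assoc _ _ _)))

    schur-- : ∀ {X Y c e} → SchurMultiple X c → SchurMultiple Y e →
              SchurMultiple (X -ₑ Y) (λ i j → c i j + (- 1#) * e i j)
    schur-- X Y = schur-+ X (schur-· (- 1#) Y)

    schur-[] : ∀ {X Y c y} → Diagonal Y y → SchurMultiple X c →
               SchurMultiple [ Y , X ] (λ i j → y i * c i j + (- 1#) * (c i j * y j))
    schur-[] Y X = schur-- (schur-∘ˡ Y X) (schur-∘ʳ X Y)

    -- Every entry of `X` has a vanishing factor: off the three central diagonals it is the entry of
    -- `A*`, by `upper` and `lower`, and on them it is the coefficient.
    schur-vanish : (∀ i j → suc (toℕ i) ℕ.< toℕ j → E i ∘ₑ A* ∘ₑ E j ≈ₑ 0ₑ) →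
                   (∀ i j → suc (toℕ j) ℕ.< toℕ i → E i ∘ₑ A* ∘ₑ E j ≈ₑ 0ₑ) →
                   ∀ {X c} → SchurMultiple X c →
                   (∀ i → c i i ≈ 0#) →
                   (∀ i j → toℕ j ≡ suc (toℕ i) → c i j ≈ 0#) →
                   (∀ i j → toℕ i ≡ suc (toℕ j) → c i j ≈ 0#) →
                   X ≈ₑ 0ₑ
    schur-vanish upper lower {X} {c} (schurMultiple entry) c-diag c-super c-sub =
      eigen-ext X 0ₑ λ j v eig → component-ext λ i →
        ≈ᴹ-trans (entry i j v eig) (≈ᴹ-trans (vanish i j v eig) (≈ᴹ-sym (End.0ᴹ-homo (E i))))
      where
      outside : ∀ i j v → Eigen j v → E i ∘ₑ A* ∘ₑ E j ≈ₑ 0ₑ → apply (E i) (apply A* v) ≈ᴹ 0ᴹ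
      outside i j v eig EA*E≈0 =
        ≈ᴹ-trans (≈ᴹ-sym (End.⟦⟧-cong (E i ∘ₑ A*) (E-identity j v eig))) (EA*E≈0 v)
      vanish : ∀ i j v → Eigen j v → c i j *ₗ apply (E i) (apply A* v) ≈ᴹ 0ᴹ
      vanish i j v eig with ℕ.<-cmp (toℕ i) (toℕ j)
      ... | tri≈ _ i≡j _ with ≡.refl ← Fin.toℕ-injective i≡j = *ₗ-zero _ (c-diag i)
      ... | tri< i<j _ _ with suc (toℕ i) ℕ.≟ toℕ j
      ...   | yes adj = *ₗ-zero _ (c-super i j (≡.sym adj))
      ...   | no ¬adj = *ₗ-zero′ _ (outside i j v eig (upper i j (ℕ.≤∧≢⇒< i<j ¬adj)))
      vanish i j v eig | tri> _ _ j<i with suc (toℕ j) ℕ.≟ toℕ i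
      ...   | yes adj = *ₗ-zero _ (c-sub i j (≡.sym adj))
      ...   | no ¬adj = *ₗ-zero′ _ (outside i j v eig (lower i j (ℕ.≤∧≢⇒< j<i ¬adj)))

    -- The commutator has coefficient (x - y) `tdPolynomial` x y relative to `A*`. It is zero on the
    -- diagonal, and since `tdPolynomial` is symmetric, exchanging x and y only changes the sign.
    -- Hence the condition on the superdiagonal also settles the subdiagonal.
    tridiagonalRelation : (∀ i j → suc (toℕ i) ℕ.< toℕ j → E i ∘ₑ A* ∘ₑ E j ≈ₑ 0ₑ) →
                          (∀ i j → suc (toℕ j) ℕ.< toℕ i → E i ∘ₑ A* ∘ₑ E j ≈ₑ 0ₑ) →
                          ∀ β γ ϱ →
                          (∀ i j → toℕ j ≡ suc (toℕ i) →
                             (θ i - θ j) * tdPolynomial commutativeRing β γ ϱ (θ i) (θ j) ≈ 0#) →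
                          0ₑ ≈ₑ [ A , A ∘ₑ A ∘ₑ A* -ₑ β ·ₑ A ∘ₑ A* ∘ₑ A +ₑ A* ∘ₑ A ∘ₑ A
                                      -ₑ γ ·ₑ (A ∘ₑ A* +ₑ A* ∘ₑ A) -ₑ ϱ ·ₑ A* ]
    tridiagonalRelation upper lower β γ ϱ vanishes v =
      ≈ᴹ-sym (schur-vanish upper lower relation diag super sub v)
      where
      open IntegerCoefficientSolver commutativeRing
      relation = schur-[] diagonal-A
        (schur-- (schur-- (schur-+ (schur--
          (schur-∘ˡ (diagonal-∘ diagonal-A diagonal-A) schur-A*)
          (schur-· β (schur-∘ʳ (schur-∘ˡ diagonal-A schur-A*) diagonal-A)))
          (schur-∘ʳ (schur-∘ʳ schur-A* diagonal-A) diagonal-A))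
          (schur-· γ (schur-+ (schur-∘ˡ diagonal-A schur-A*) (schur-∘ʳ schur-A* diagonal-A))))
          (schur-· ϱ schur-A*))
      -- This repeats unsimplified the coefficient that the `schur` rules assign to `relation`; the
      -- solver does the simplification below.
      coefficient : Carrier → Carrier → Carrier
      coefficient x y = x * t + (- 1#) * (t * y)
        where
        t : Carrier
        t = x * x * 1# + (- 1#) * (β * (x * 1# * y)) + 1# * y * y
            + (- 1#) * (γ * (x * 1# + 1# * y)) + (- 1#) * (ϱ * 1#)
      t≔ = λ {k} (one β γ ϱ x y : Polynomial k) →
            x :* x :* one :+ (:- one) :* (β :* (x :* one :* y)) :+ one :* y :* y
            :+ (:- one) :* (γ :* (x :* one :+ one :* y)) :+ (:- one) :* (ϱ :* one)
      q≔ = λ {k} (β γ ϱ x y : Polynomial k) →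
            x :* x :- β :* (x :* y) :+ y :* y :- γ :* (x :+ y) :- ϱ
      diag : ∀ i → coefficient (θ i) (θ i) ≈ 0#
      diag i = solve 4 (λ β γ ϱ x →
          x :* t≔ (con (1 , 0)) β γ ϱ x x :+ (:- con (1 , 0)) :* (t≔ (con (1 , 0)) β γ ϱ x x :* x)
          := con (0 , 0))
        refl β γ ϱ (θ i)
      super : ∀ i j → toℕ j ≡ suc (toℕ i) → coefficient (θ i) (θ j) ≈ 0#
      super i j adj = trans
        (solve 5 (λ β γ ϱ x y →
            x :* t≔ (con (1 , 0)) β γ ϱ x y :+ (:- con (1 , 0)) :* (t≔ (con (1 , 0)) β γ ϱ x y :* y)
            := (x :- y) :* q≔ β γ ϱ x y)
          refl β γ ϱ (θ i) (θ j))
        (vanishes i j adj)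
      sub : ∀ i j → toℕ i ≡ suc (toℕ j) → coefficient (θ i) (θ j) ≈ 0#
      sub i j adj = trans
        (solve 5 (λ β γ ϱ x y →
            x :* t≔ (con (1 , 0)) β γ ϱ x y :+ (:- con (1 , 0)) :* (t≔ (con (1 , 0)) β γ ϱ x y :* y)
            := (:- con (1 , 0)) :* ((y :- x) :* q≔ β γ ϱ y x))
          refl β γ ϱ (θ i) (θ j))
        (trans (*-congˡ (vanishes j i adj)) (zeroʳ (- 1#)))

-- A Hessenberg operator `H` in an eigenbasis of `A`: leading terms and cyclicity.

module Hessenberg {c ℓ m ℓm} {F : Field c ℓ} {V : VectorSpace F m ℓm}
  {d} (A : End V) (E : Fin (suc d) → End V)
  (multiplicityFree : MultiplicityFree A) (E-idempotents : IsOrderingOfPrimitiveIdempotents A E)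
  (H : End V)
  (EHE≈0 : ∀ i j → suc (toℕ j) ℕ.< toℕ i → E i ∘ₑ H ∘ₑ E j ≈ₑ 0ₑ)
  (EHE≉0 : ∀ i j → toℕ i ≡ suc (toℕ j) → E i ∘ₑ H ∘ₑ E j ≉ₑ 0ₑ) where

  open Field F
  open VectorSpace V
  open VectorSpaceProperties V
  open End using (apply)
  open Spectral A E multiplicityFree E-idempotents
  open SetoidReasoning ≈ᴹ-setoid

  -- Eigenvectors of A normalised so that the subdiagonal entries of H are 1.
  w : ℕ → Carrierᴹ
  w zero    = eigenvector Fin.zero
  w (suc n) = apply (E (clamp d (suc n))) (apply H (w n))

  w-eigen : ∀ n → Eigen (clamp d n) (w n)
  w-eigen zero    = eigenvector-eigen Fin.zero
  w-eigen (suc n) = E-eigen (clamp d (suc n)) (apply H (w n))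

  -- If the scalar of `w (suc n)` were zero, then `H` followed by the next idempotent would kill the
  -- line of `w n`. That line contains the image of the n-th idempotent, so a subdiagonal product
  -- would vanish against `EHE≉0`.
  w-scale : ∀ n → n ≤ d → ∃[ a ] ∃[ a⁻¹ ] (w n ≈ᴹ a *ₗ eigenvector (clamp d n)) × (a⁻¹ * a ≈ 1#)
  w-scale zero    _   = 1# , 1# , ≈ᴹ-sym (*ₗ-identityˡ _) , *-identityˡ 1#
  w-scale (suc n) n<d with w-scale n (ℕ.<⇒≤ n<d) | eigenvector-spans (clamp d (suc n)) (w (suc n)) (w-eigen (suc n))
  ... | a , a⁻¹ , w≈ , inv | b , w′≈ with ≉0⇒invertible b b≉0
    where
    b≉0 : ¬ b ≈ 0#
    b≉0 b≈0 = EHE≉0 (clamp d (suc n)) (clamp d n)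
      (≡.trans (toℕ-clamp n<d) (≡.cong suc (≡.sym (toℕ-clamp (ℕ.<⇒≤ n<d)))))
      λ v → let (k , Ev≈) = eigenvector-spans (clamp d n) _ (E-eigen (clamp d n) v)
                EH = E (clamp d (suc n)) ∘ₑ H in begin
        apply EH (apply (E (clamp d n)) v)              ≈⟨ End.⟦⟧-cong EH Ev≈ ⟩
        apply EH (k *ₗ eigenvector (clamp d n))         ≈⟨ End.*ₗ-homo EH _ _ ⟩
        k *ₗ apply EH (eigenvector (clamp d n))         ≈⟨ *ₗ-zero′ k (invertible-cancel inv (≈ᴹ-trans (≈ᴹ-sym (End.*ₗ-homo EH _ _))
                                                            (≈ᴹ-trans (End.⟦⟧-cong EH (≈ᴹ-sym w≈)) (≈ᴹ-trans w′≈ (*ₗ-zero _ b≈0))))) ⟩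
        0ᴹ                                              ∎
  ... | b⁻¹ , inverse , _ = b , b⁻¹ , w′≈ , inverse

  w-spans : ∀ n → n ≤ d → ∀ v → Eigen (clamp d n) v → ∃[ a ] v ≈ᴹ a *ₗ w n
  w-spans n n≤d v eig with w-scale n n≤d | eigenvector-spans (clamp d n) v eig
  ... | a , a⁻¹ , w≈ , inv | b , v≈ = b * a⁻¹ , (begin
    v                                                ≈⟨ v≈ ⟩
    b *ₗ eigenvector (clamp d n)                     ≈⟨ *ₗ-congˡ (*ₗ-identityˡ _) ⟨
    b *ₗ (1# *ₗ eigenvector (clamp d n))             ≈⟨ *ₗ-congˡ (*ₗ-congʳ inv) ⟨
    b *ₗ ((a⁻¹ * a) *ₗ eigenvector (clamp d n))      ≈⟨ *ₗ-congˡ (*ₗ-assoc _ _ _) ⟩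
    b *ₗ (a⁻¹ *ₗ (a *ₗ eigenvector (clamp d n)))     ≈⟨ *ₗ-congˡ (*ₗ-congˡ w≈) ⟨
    b *ₗ (a⁻¹ *ₗ w n)                                ≈⟨ *ₗ-assoc _ _ _ ⟨
    (b * a⁻¹) *ₗ w n                                 ∎)

  w-independent : ∀ n → n ≤ d → ∀ b → b *ₗ w n ≈ᴹ 0ᴹ → b ≈ 0#
  w-independent n n≤d b bw≈0 with w-scale n n≤d
  ... | a , a⁻¹ , w≈ , inv = eigenvector-independent (clamp d n) b (invertible-cancel inv (begin
    a *ₗ (b *ₗ eigenvector (clamp d n))   ≈⟨ *ₗ-comm a b _ ⟩
    b *ₗ (a *ₗ eigenvector (clamp d n))   ≈⟨ *ₗ-congˡ w≈ ⟨
    b *ₗ w n                              ≈⟨ bw≈0 ⟩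
    0ᴹ                                    ∎))

  -- For n ≤ d this is membership in the span of `w 0`, ..., `w (n - 1)`; for larger n it is
  -- vacuous.
  VanishesFrom : ℕ → Carrierᴹ → Set ℓm
  VanishesFrom n x = ∀ i → n ≤ toℕ i → apply (E i) x ≈ᴹ 0ᴹ

  -- For n ≤ d: `x` is `a *ₗ w n` plus a combination of earlier `w k`, as for a polynomial of degree
  -- at most n with coefficient `a` at degree n. For n > d both fields are vacuous, so the rules
  -- below need no bounds.
  record Leading (n : ℕ) (a : Carrier) (x : Carrierᴹ) : Set ℓm where
    constructor _,ₗ_
    field
      above : VanishesFrom (suc n) x
      at    : ∀ i → toℕ i ≡ n → apply (E i) x ≈ᴹ a *ₗ w n

  clamp-unique : ∀ {i : Fin (suc d)} {n} → toℕ i ≡ n → clamp d n ≡ i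
  clamp-unique {i} ≡.refl = clamp-toℕ i

  leading-w : ∀ n → Leading n 1# (w n)
  leading-w n .Leading.above i n<i = E-zero i (clamp d n)
    (λ eq → ℕ.<⇒≱ n<i (≡.subst (λ j → toℕ j ≤ n) eq (toℕ-clamp-≤ d n))) (w n) (w-eigen n)
  leading-w n .Leading.at i i≡n with ≡.refl ← clamp-unique {i} i≡n =
    ≈ᴹ-trans (E-identity i (w n) (w-eigen n)) (≈ᴹ-sym (*ₗ-identityˡ _))

  leading-+ : ∀ {n a b x y} → Leading n a x → Leading n b y → Leading n (a + b) (x +ᴹ y)
  leading-+ (above ,ₗ at) (above′ ,ₗ at′) =
    (λ i n<i → ≈ᴹ-trans (End.+ᴹ-homo (E i) _ _)
      (≈ᴹ-trans (+ᴹ-cong (above i n<i) (above′ i n<i)) (+ᴹ-identityʳ 0ᴹ))) ,ₗ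
    (λ i i≡n → ≈ᴹ-trans (End.+ᴹ-homo (E i) _ _)
      (≈ᴹ-trans (+ᴹ-cong (at i i≡n) (at′ i i≡n)) (≈ᴹ-sym (*ₗ-distribʳ _ _ _))))

  leading-· : ∀ b {n a x} → Leading n a x → Leading n (b * a) (b *ₗ x)
  leading-· b (above ,ₗ at) =
    (λ i n<i → ≈ᴹ-trans (End.*ₗ-homo (E i) _ _) (*ₗ-zero′ b (above i n<i))) ,ₗ
    (λ i i≡n → ≈ᴹ-trans (End.*ₗ-homo (E i) _ _)
      (≈ᴹ-trans (*ₗ-congˡ (at i i≡n)) (≈ᴹ-sym (*ₗ-assoc _ _ _))))

  leading-- : ∀ {n a b x y} → Leading n a x → Leading n b y → Leading n (a + (- 1#) * b) (x -ᵛ y)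
  leading-- x y = leading-+ x (leading-· (- 1#) y)

  leading-raise : ∀ {n a x} → Leading n a x → Leading (suc n) 0# x
  leading-raise {n} (above ,ₗ at) =
    (λ i n<i → above i (ℕ.<⇒≤ n<i)) ,ₗ
    (λ i i≡n → ≈ᴹ-trans (above i (ℕ.≤-reflexive (≡.sym i≡n))) (≈ᴹ-sym (*ₗ-zeroˡ _)))

  leading-A : ∀ {n a x} → Leading n a x → Leading n (θ (clamp d n) * a) (apply A x)
  leading-A (above ,ₗ at) =
    (λ i n<i → ≈ᴹ-trans (E∘A i _) (*ₗ-zero′ _ (above i n<i))) ,ₗ
    (λ i i≡n → ≈ᴹ-trans (E∘A i _) (≈ᴹ-trans (*ₗ-cong (θ≈ i≡n) (at i i≡n)) (≈ᴹ-sym (*ₗ-assoc _ _ _))))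
    where
    θ≈ : ∀ {i n} → toℕ i ≡ n → θ i ≈ θ (clamp d n)
    θ≈ i≡n = reflexive (≡.cong θ (≡.sym (clamp-unique i≡n)))

  -- The Hessenberg shape lets `H` raise the degree by at most one. The coefficient is unchanged
  -- because `w (suc n)` is by definition the top component of `H` applied to `w n`.
  leading-H : ∀ {n a x} → Leading n a x → Leading (suc n) a (apply H x)
  leading-H {n} {a} {x} (above ,ₗ at) = above′ ,ₗ at′
    where
    EH-expand : ∀ i → apply (E i) (apply H x) ≈ᴹ sum (λ j → apply (E i) (apply H (apply (E j) x)))
    EH-expand i = ≈ᴹ-trans (End.⟦⟧-cong (E i ∘ₑ H) (≈ᴹ-sym (resolution x)))
      (apply-sum (E i ∘ₑ H) (λ j → apply (E j) x))
    EH-zero : ∀ i j → n ℕ.< toℕ j → apply (E i) (apply H (apply (E j) x)) ≈ᴹ 0ᴹ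
    EH-zero i j n<j = ≈ᴹ-trans (End.⟦⟧-cong (E i ∘ₑ H) (above j n<j)) (End.0ᴹ-homo (E i ∘ₑ H))
    above′ : VanishesFrom (suc (suc n)) (apply H x)
    above′ i n<i = ≈ᴹ-trans (EH-expand i) (sum-zero _ term)
      where
      term : ∀ j → apply (E i) (apply H (apply (E j) x)) ≈ᴹ 0ᴹ
      term j with n ℕ.<? toℕ j
      ... | yes n<j = EH-zero i j n<j
      ... | no  n≮j = EHE≈0 i j (ℕ.≤-<-trans (ℕ.s≤s (ℕ.≮⇒≥ n≮j)) n<i) x
    at′ : ∀ i → toℕ i ≡ suc n → apply (E i) (apply H x) ≈ᴹ a *ₗ w (suc n)
    at′ i i≡sn with ≡.refl ← clamp-unique {i} i≡sn = begin
      apply (E i) (apply H x)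
        ≈⟨ EH-expand i ⟩
      sum (λ j → apply (E i) (apply H (apply (E j) x)))
        ≈⟨ sum-single _ k term ⟩
      apply (E i) (apply H (apply (E k) x))
        ≈⟨ End.⟦⟧-cong (E i ∘ₑ H) (at k k≡n) ⟩
      apply (E i) (apply H (a *ₗ w n))
        ≈⟨ End.*ₗ-homo (E i ∘ₑ H) _ _ ⟩
      a *ₗ w (suc n) ∎
      where
      k : Fin (suc d)
      k = clamp d n
      k≡n : toℕ k ≡ n
      k≡n = toℕ-clamp (ℕ.<⇒≤ (≡.subst (_≤ d) i≡sn (Fin.toℕ≤pred[n] i)))
      term : ∀ j → j ≢ k → apply (E i) (apply H (apply (E j) x)) ≈ᴹ 0ᴹ
      term j j≢k with ℕ.<-cmp (toℕ j) n
      ... | tri< j<n _ _  = EHE≈0 i j (≡.subst (suc (toℕ j) ℕ.<_) (≡.sym i≡sn) (ℕ.s≤s j<n)) x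
      ... | tri≈ _ j≡n _  = ⊥-elim (j≢k (≡.sym (clamp-unique j≡n)))
      ... | tri> _ _ n<j  = EH-zero i j n<j

  -- Comparison of coefficients at `w n`, which is a nonzero component because n ≤ d.
  leading-unique : ∀ {n a b x y} → n ≤ d → x ≈ᴹ y → Leading n a x → Leading n b y → a ≈ b
  leading-unique {n} {a} {b} {x} {y} n≤d x≈y X Y =
    x∙y⁻¹≈ε⇒x≈y a b (w-independent n n≤d (a - b) (≈ᴹ-trans (*ₗ-minus a b (w n)) (≈⇒-ᵛ≈0 (begin
      a *ₗ w n                      ≈⟨ Leading.at X (clamp d n) (toℕ-clamp n≤d) ⟨
      apply (E (clamp d n)) x       ≈⟨ End.⟦⟧-cong (E (clamp d n)) x≈y ⟩
      apply (E (clamp d n)) y       ≈⟨ Leading.at Y (clamp d n) (toℕ-clamp n≤d) ⟩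
      b *ₗ w n                      ∎))))
    where open import Algebra.Properties.Group +-group using (x∙y⁻¹≈ε⇒x≈y)

  -- One step of triangular elimination: the n-th component of `x` is a multiple of `w n`, which is
  -- also the n-th component of `y`.
  peel : ∀ {n x y} → n ≤ d → VanishesFrom (suc n) x → Leading n 1# y →
         ∃[ a ] VanishesFrom n (x -ᵛ a *ₗ y)
  peel {n} {x} {y} n≤d above Y with w-spans n n≤d _ (E-eigen (clamp d n) x)
  ... | a , Ex≈ = a , below
    where
    below : VanishesFrom n (x -ᵛ a *ₗ y)
    below i n≤i with toℕ i ℕ.≟ n
    ... | yes i≡n with ≡.refl ← clamp-unique {i} i≡n = begin
      apply (E i) (x -ᵛ a *ₗ y)                 ≈⟨ apply-minus (E i) _ _ ⟩
      apply (E i) x -ᵛ apply (E i) (a *ₗ y)     ≈⟨ -ᵛ-cong Ex≈ (End.*ₗ-homo (E i) _ _) ⟩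
      a *ₗ w n -ᵛ a *ₗ apply (E i) y            ≈⟨ -ᵛ-cong ≈ᴹ-refl (*ₗ-congˡ (≈ᴹ-trans (Leading.at Y i i≡n) (*ₗ-identityˡ _))) ⟩
      a *ₗ w n -ᵛ a *ₗ w n                      ≈⟨ -ᵛ-self _ ⟩
      0ᴹ                                        ∎
    ... | no  i≢n = begin
      apply (E i) (x -ᵛ a *ₗ y)                 ≈⟨ apply-minus (E i) _ _ ⟩
      apply (E i) x -ᵛ apply (E i) (a *ₗ y)     ≈⟨ -ᵛ-cong (above i n<i) (≈ᴹ-trans (End.*ₗ-homo (E i) _ _) (*ₗ-zero′ a (Leading.above Y i n<i))) ⟩
      0ᴹ -ᵛ 0ᴹ                                  ≈⟨ -ᵛ-self 0ᴹ ⟩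
      0ᴹ                                        ∎
      where
      n<i : n ℕ.< toℕ i
      n<i = ℕ.≤∧≢⇒< n≤i (i≢n ∘ ≡.sym)

  vanishes-zero : ∀ {x} → VanishesFrom 0 x → x ≈ᴹ 0ᴹ
  vanishes-zero zero-components = component-ext λ i →
    ≈ᴹ-trans (zero-components i ℕ.z≤n) (≈ᴹ-sym (End.0ᴹ-homo (E i)))

  -- The vectors `w 0`, H `w 0`, H² `w 0`, H³ `w 0` are unitriangular over `w 0`, ..., `w 3`, so
  -- elimination from the top degree downwards leaves nothing.
  cubicCombination : 3 ≤ d → ∀ {x} → VanishesFrom 4 x → ∃[ α₀ ] ∃[ α₁ ] ∃[ α₂ ] ∃[ α₃ ]
    x ≈ᴹ α₀ *ₗ w 0 +ᴹ α₁ *ₗ apply H (w 0) +ᴹ α₂ *ₗ apply H (apply H (w 0))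
         +ᴹ α₃ *ₗ apply H (apply H (apply H (w 0)))
  cubicCombination 3≤d {x} below₄ = α₀ , α₁ , α₂ , α₃ ,
    -ᵛ≈⇒≈+ (-ᵛ≈⇒≈+ (-ᵛ≈⇒≈+ (-ᵛ≈0⇒≈ (vanishes-zero (proj₂ peel₀)))))
    where
    h₁ h₂ h₃ x₃ x₂ x₁ : Carrierᴹ
    α₀ α₁ α₂ α₃ : Carrier
    h₁ = apply H (w 0)
    h₂ = apply H h₁
    h₃ = apply H h₂

    peel₃ : ∃[ a ] VanishesFrom 3 (x -ᵛ a *ₗ h₃)
    peel₃ = peel 3≤d below₄ (leading-H (leading-H (leading-H (leading-w 0))))
    α₃ = proj₁ peel₃
    x₃ = x -ᵛ α₃ *ₗ h₃

    peel₂ : ∃[ a ] VanishesFrom 2 (x₃ -ᵛ a *ₗ h₂)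
    peel₂ = peel (ℕ.m+n≤o⇒n≤o 1 3≤d) (proj₂ peel₃) (leading-H (leading-H (leading-w 0)))
    α₂ = proj₁ peel₂
    x₂ = x₃ -ᵛ α₂ *ₗ h₂

    peel₁ : ∃[ a ] VanishesFrom 1 (x₂ -ᵛ a *ₗ h₁)
    peel₁ = peel (ℕ.m+n≤o⇒n≤o 2 3≤d) (proj₂ peel₂) (leading-H (leading-w 0))
    α₁ = proj₁ peel₁
    x₁ = x₂ -ᵛ α₁ *ₗ h₁

    peel₀ : ∃[ a ] VanishesFrom 0 (x₁ -ᵛ a *ₗ w 0)
    peel₀ = peel ℕ.z≤n (proj₂ peel₁) (leading-w 0)
    α₀ = proj₁ peel₀

  -- By strong induction every `w n` lies in `P`: among the components of H `w n`, those up to n are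
  -- multiples of earlier `w k`, those beyond n + 1 are zero, so the one at n + 1 remains in `P`
  -- after subtraction. The `w n` with n ≤ d span V.
  w₀-cyclic : ∀ {p} {P : Subset V p} → IsSubspace P → (∀ {x} → P x → P (apply H x)) → P (w 0) →
              ∀ x → P x
  w₀-cyclic {P = P} subspace H-closed Pw₀ x =
    resp (resolution x) (sum-closed Pw₀ _ (λ i →
      component∈P i (w∈P (toℕ i) (toℕ i) ℕ.≤-refl) x))
    where
    open IsSubspace subspace

    component∈P : ∀ i → P (w (toℕ i)) → ∀ x → P (apply (E i) x)
    component∈P i Pw x with w-spans (toℕ i) (Fin.toℕ≤pred[n] i) (apply (E i) x)
                              (≡.subst (λ j → Eigen j (apply (E i) x)) (≡.sym (clamp-toℕ i)) (E-eigen i x))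
    ... | a , Ex≈ = resp (≈ᴹ-sym Ex≈) (·-closed a Pw)

    w-step : ∀ n → (∀ k → k ≤ n → P (w k)) → P (w (suc n))
    w-step n Pw = sum-extract (λ j → apply (E j) (apply H (w n))) (clamp d (suc n))
      (resp (≈ᴹ-sym (resolution _)) (H-closed (Pw n ℕ.≤-refl))) others
      where
      others : ∀ j → j ≢ clamp d (suc n) → P (apply (E j) (apply H (w n)))
      others j j≢ with toℕ j ℕ.≤? n
      ... | yes j≤n = component∈P j (Pw (toℕ j) j≤n) _
      ... | no  j≰n = resp
        (≈ᴹ-sym (Leading.above (leading-H (leading-w n)) j
          (ℕ.≤∧≢⇒< (ℕ.≰⇒> j≰n) (λ sn≡j → j≢ (≡.sym (clamp-unique (≡.sym sn≡j)))))))
        (resp (*ₗ-zeroˡ _) (·-closed 0# Pw₀))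

    -- The extra bound `n` turns the strong induction on `k` into a structural recursion.
    w∈P : ∀ n k → k ≤ n → P (w k)
    w∈P n       zero    _           = Pw₀
    w∈P (suc n) (suc k) (ℕ.s≤s k≤n) = w-step k (λ l l≤k → w∈P n l (ℕ.≤-trans l≤k k≤n))

-- Commutators with `A*` in a tridiagonal Hessenberg system.

module TridiagonalHessenberg {c ℓ m ℓm} {F : Field c ℓ} {V : VectorSpace F m ℓm} {d : ℕ}
  (Φ : HessenbergSystem V d) (tridiagonal : IsTridiagonal Φ) where

  open Field F
  open VectorSpace V
  open VectorSpaceProperties V
  open End using (apply)
  open HessenbergSystem Φ
  open IntegerCoefficientSolver commutativeRing
    using (Polynomial; solve; _:=_; _:+_; _:*_; :-_; _:-_; con)
  module S  = Spectral A E A-multiplicityFree E-idempotents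
  module S* = Spectral A* E* A*-multiplicityFree E*-idempotents
  open S using (θ; Diagonal)
  open S* using () renaming (θ to θ*)
  -- The roles are exchanged here: `w`, `VanishesFrom` and `Leading` refer to an eigenbasis of `A*`,
  -- and `A` is the Hessenberg operator.
  open Hessenberg A* E* A*-multiplicityFree E*-idempotents A E*AE*≈0 E*AE*≉0

  tdPolynomials⇒TD : ∀ β γ γ* ϱ ϱ* →
    (∀ i j → toℕ j ≡ suc (toℕ i) → (θ i - θ j) * tdPolynomial commutativeRing β γ ϱ (θ i) (θ j) ≈ 0#) →
    (∀ i j → toℕ j ≡ suc (toℕ i) → (θ* i - θ* j) * tdPolynomial commutativeRing β γ* ϱ* (θ* i) (θ* j) ≈ 0#) →
    IsTD Φ
  tdPolynomials⇒TD β γ γ* ϱ ϱ* vanishes vanishes* = β , γ , γ* , ϱ , ϱ* ,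
    S.tridiagonalRelation A* (λ i j i<j → proj₁ (tridiagonal i j i<j)) EA*E≈0 β γ ϱ vanishes ,
    S*.tridiagonalRelation A (λ i j i<j → proj₂ (tridiagonal i j i<j)) E*AE*≈0 β γ* ϱ* vanishes*

  -- This is `A` [`A` , `A*`] `A`, whose coefficient relative to `A*` at position (i, j) is θᵢ θⱼ
  -- (θᵢ - θⱼ).
  C : End V
  C = A ∘ₑ A ∘ₑ A* ∘ₑ A -ₑ A ∘ₑ A* ∘ₑ A ∘ₑ A

  -- Relative to `A*`, the difference of the two sides has coefficient θᵢ θⱼ (θᵢ - θⱼ) - (yᵢ - yⱼ).
  -- It is antisymmetric in i and j, so consecutive indices in one order suffice. It is applied both
  -- to `Z` and to the cubic in `A`.
  C-commutator : ∀ {Y y} → Diagonal Y y →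
    (∀ i j → toℕ j ≡ suc (toℕ i) → y i - y j ≈ θ i * θ j * (θ i - θ j)) →
    C ≈ₑ [ Y , A* ]
  C-commutator {Y} {y} D differences v = -ᵛ≈0⇒≈
    (S.schur-vanish A* (λ i j i<j → proj₁ (tridiagonal i j i<j)) EA*E≈0 entries diag super sub v)
    where
    entries = S.schur-- A*
      (S.schur-- A*
        (S.schur-∘ʳ A* (S.schur-∘ˡ A* (S.diagonal-∘ S.diagonal-A S.diagonal-A) (S.schur-A* A*)) S.diagonal-A)
        (S.schur-∘ʳ A* (S.schur-∘ʳ A* (S.schur-∘ˡ A* S.diagonal-A (S.schur-A* A*)) S.diagonal-A) S.diagonal-A))
      (S.schur-[] A* D (S.schur-A* A*))
    coefficient : (x y u v : Carrier) → Carrier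
    coefficient x y u v = (x * x * 1# * y + (- 1#) * (x * 1# * y * y))
                          + (- 1#) * (u * 1# + (- 1#) * (1# * v))
    coefficient≔ = λ {k} (x y u v : Polynomial k) → let one = con (1 , 0) in
      (x :* x :* one :* y :+ (:- one) :* (x :* one :* y :* y))
      :+ (:- one) :* (u :* one :+ (:- one) :* (one :* v))
    diag : ∀ i → coefficient (θ i) (θ i) (y i) (y i) ≈ 0#
    diag i = solve 2 (λ x u → coefficient≔ x x u u := con (0 , 0)) refl (θ i) (y i)
    super : ∀ i j → toℕ j ≡ suc (toℕ i) → coefficient (θ i) (θ j) (y i) (y j) ≈ 0#
    super i j adj = begin
      coefficient (θ i) (θ j) (y i) (y j)
        ≈⟨ solve 4 (λ x y u v → coefficient≔ x y u v := x :* y :* (x :- y) :- (u :- v))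
             refl (θ i) (θ j) (y i) (y j) ⟩
      θ i * θ j * (θ i - θ j) - (y i - y j)
        ≈⟨ +-congˡ (-‿cong (differences i j adj)) ⟩
      θ i * θ j * (θ i - θ j) - θ i * θ j * (θ i - θ j)
        ≈⟨ -‿inverseʳ _ ⟩
      0# ∎
      where open SetoidReasoning setoid
    sub : ∀ i j → toℕ i ≡ suc (toℕ j) → coefficient (θ i) (θ j) (y i) (y j) ≈ 0#
    sub i j adj = begin
      coefficient (θ i) (θ j) (y i) (y j)
        ≈⟨ solve 4 (λ x y u v → coefficient≔ x y u v := (v :- u) :- y :* x :* (y :- x))
             refl (θ i) (θ j) (y i) (y j) ⟩
      (y j - y i) - θ j * θ i * (θ j - θ i)
        ≈⟨ +-congʳ (differences j i adj) ⟩
      θ j * θ i * (θ j - θ i) - θ j * θ i * (θ j - θ i)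
        ≈⟨ -‿inverseʳ _ ⟩
      0# ∎
      where open SetoidReasoning setoid

  -- Three factors `A` raise the degree by three. In the first term of `C` the factor `A*` acts at
  -- degree n + 1, in the second at degree n + 2, which gives the two eigenvalues.
  leading-C : ∀ {n} → Leading (3 ℕ.+ n)
    (θ* (clamp d (1 ℕ.+ n)) * 1# + (- 1#) * (θ* (clamp d (2 ℕ.+ n)) * 1#)) (apply C (w n))
  leading-C {n} = leading-- (leading-H (leading-H (leading-A (leading-H (leading-w n)))))
                            (leading-H (leading-A (leading-H (leading-H (leading-w n)))))

  -- The eigenvalues of an operator Z with [ Z , A* ] = C.
  z : ℕ → Carrier
  z zero    = 0#
  z (suc n) = z n - θ (clamp d n) * θ (clamp d (suc n)) * (θ (clamp d n) - θ (clamp d (suc n)))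

  z-difference : ∀ i j → toℕ j ≡ suc (toℕ i) → z (toℕ i) - z (toℕ j) ≈ θ i * θ j * (θ i - θ j)
  z-difference i j adj with ≡.refl ← clamp-unique {j} adj
                       rewrite adj | clamp-toℕ i =
    solve 2 (λ z p → z :- (z :- p) := p) refl (z (toℕ i)) _

  Z : End V
  Z = S.withEigenvalues (λ i → z (toℕ i))

  Z-diagonal : Diagonal Z (λ i → z (toℕ i))
  Z-diagonal = S.diagonal-withEigenvalues (λ i → z (toℕ i))

  -- The i-th component of [`Z` , `A*`] `w 0` is (θ*₀ - θ*ᵢ) times that of `Z` `w 0`. It equals the
  -- i-th component of `C` `w 0`, which is zero for i ≥ 4, and the scalar is invertible.
  Zw₀-vanishesFrom-4 : VanishesFrom 4 (apply Z (w 0))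
  Zw₀-vanishesFrom-4 i 4≤i = invertible-cancel
    (proj₂ (S*.θ-difference-invertible 0≢i))
    (begin
      (θ* Fin.zero - θ* i) *ₗ Eu
        ≈⟨ *ₗ-minus _ _ _ ⟩
      θ* Fin.zero *ₗ Eu -ᵛ θ* i *ₗ Eu
        ≈⟨ -ᵛ-cong (≈ᴹ-sym (End.*ₗ-homo (E* i ∘ₑ Z) _ _)) (≈ᴹ-sym (S*.E∘A i _)) ⟩
      apply (E* i ∘ₑ Z) (θ* Fin.zero *ₗ w 0) -ᵛ apply (E* i) (apply A* (apply Z (w 0)))
        ≈⟨ -ᵛ-cong (≈ᴹ-sym (End.⟦⟧-cong (E* i ∘ₑ Z) (w-eigen 0))) ≈ᴹ-refl ⟩
      apply (E* i) (apply Z (apply A* (w 0))) -ᵛ apply (E* i) (apply A* (apply Z (w 0)))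
        ≈⟨ apply-minus (E* i) _ _ ⟨
      apply (E* i) (apply [ Z , A* ] (w 0))
        ≈⟨ End.⟦⟧-cong (E* i) (C-commutator Z-diagonal z-difference (w 0)) ⟨
      apply (E* i) (apply C (w 0))
        ≈⟨ Leading.above leading-C i 4≤i ⟩
      0ᴹ ∎)
    where
    open SetoidReasoning ≈ᴹ-setoid
    Eu : Carrierᴹ
    Eu = apply (E* i) (apply Z (w 0))
    0≢i : Fin.zero ≢ i
    0≢i eq = ℕ.<⇒≢ (ℕ.≤-trans (ℕ.s≤s ℕ.z≤n) 4≤i) (≡.cong toℕ eq)

  -- Identification of `Z` with a cubic polynomial in `A`.

  cubicₑ : (α₀ α₁ α₂ α₃ : Carrier) → End V
  cubicₑ α₀ α₁ α₂ α₃ = α₀ ·ₑ idₑ +ₑ α₁ ·ₑ A +ₑ α₂ ·ₑ (A ∘ₑ A) +ₑ α₃ ·ₑ (A ∘ₑ A ∘ₑ A)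

  cubicₑ-diagonal : ∀ α₀ α₁ α₂ α₃ →
    Diagonal (cubicₑ α₀ α₁ α₂ α₃) (λ i → cubic commutativeRing α₀ α₁ α₂ α₃ (θ i))
  cubicₑ-diagonal α₀ α₁ α₂ α₃ =
    S.diagonal-+ (S.diagonal-+ (S.diagonal-+
      (S.diagonal-· α₀ S.diagonal-id)
      (S.diagonal-· α₁ S.diagonal-A))
      (S.diagonal-· α₂ (S.diagonal-∘ S.diagonal-A S.diagonal-A)))
      (S.diagonal-· α₃ (S.diagonal-∘ (S.diagonal-∘ S.diagonal-A S.diagonal-A) S.diagonal-A))

  -- Only the cubic term reaches degree n + 3; the summands with `0#` are the lower terms, brought
  -- to that degree by `leading-raise`.
  leading-cubicₑ : ∀ α₀ α₁ α₂ α₃ {n a x} → Leading n a x →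
    Leading (3 ℕ.+ n) (α₀ * 0# + α₁ * 0# + α₂ * 0# + α₃ * a) (apply (cubicₑ α₀ α₁ α₂ α₃) x)
  leading-cubicₑ α₀ α₁ α₂ α₃ x =
    leading-+ (leading-+ (leading-+
      (leading-· α₀ (leading-raise (leading-raise (leading-raise x))))
      (leading-· α₁ (leading-raise (leading-raise (leading-H x)))))
      (leading-· α₂ (leading-raise (leading-H (leading-H x)))))
      (leading-· α₃ (leading-H (leading-H (leading-H x))))

  Zw₀-cubic : 3 ≤ d → ∃[ α₀ ] ∃[ α₁ ] ∃[ α₂ ] ∃[ α₃ ]
              apply Z (w 0) ≈ᴹ apply (cubicₑ α₀ α₁ α₂ α₃) (w 0)
  Zw₀-cubic 3≤d = cubicCombination 3≤d Zw₀-vanishesFrom-4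

  -- Both operators are diagonal in an eigenbasis of `A`, so the kernel of their difference is an
  -- `A`-invariant subspace. It contains `w 0`, hence is all of V by `w₀-cyclic`, and evaluation at
  -- the i-th eigenvector of `A` compares the eigenvalues.
  z-cubic : ∀ α₀ α₁ α₂ α₃ → apply Z (w 0) ≈ᴹ apply (cubicₑ α₀ α₁ α₂ α₃) (w 0) →
            ∀ i → z (toℕ i) ≈ cubic commutativeRing α₀ α₁ α₂ α₃ (θ i)
  z-cubic α₀ α₁ α₂ α₃ Zw₀≈ i = x∙y⁻¹≈ε⇒x≈y _ _
    (S.eigenvector-independent i _ (begin
      (zᵢ i - p i) *ₗ e                                   ≈⟨ *ₗ-minus _ _ _ ⟩
      zᵢ i *ₗ e -ᵛ p i *ₗ e                               ≈⟨ -ᵛ-cong (*ₗ-congˡ Ee≈e) (*ₗ-congˡ Ee≈e) ⟨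
      zᵢ i *ₗ apply (E i) e -ᵛ p i *ₗ apply (E i) e       ≈⟨ ≈⇒-ᵛ≈0 (w₀-cyclic subspace A-closed w₀∈W e i) ⟩
      0ᴹ                                                  ∎))
    where
    open import Algebra.Properties.Group +-group using (x∙y⁻¹≈ε⇒x≈y)
    open SetoidReasoning ≈ᴹ-setoid
    zᵢ p : Fin (suc d) → Carrier
    zᵢ i = z (toℕ i)
    p  i = cubic commutativeRing α₀ α₁ α₂ α₃ (θ i)

    e : Carrierᴹ
    e = S.eigenvector i

    Ee≈e : apply (E i) e ≈ᴹ e
    Ee≈e = S.E-identity i e (S.eigenvector-eigen i)

    -- The kernel of Z - cubicₑ α₀ α₁ α₂ α₃.
    W : Subset V ℓm
    W x = ∀ i → zᵢ i *ₗ apply (E i) x ≈ᴹ p i *ₗ apply (E i) x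

    scaled : ∀ {i a x y} → apply (E i) y ≈ᴹ a *ₗ apply (E i) x →
             zᵢ i *ₗ apply (E i) x ≈ᴹ p i *ₗ apply (E i) x →
             zᵢ i *ₗ apply (E i) y ≈ᴹ p i *ₗ apply (E i) y
    scaled {i} {a} {x} {y} Ey≈aEx eq = begin
      zᵢ i *ₗ apply (E i) y             ≈⟨ *ₗ-congˡ Ey≈aEx ⟩
      zᵢ i *ₗ (a *ₗ apply (E i) x)      ≈⟨ *ₗ-comm _ _ _ ⟩
      a *ₗ (zᵢ i *ₗ apply (E i) x)      ≈⟨ *ₗ-congˡ eq ⟩
      a *ₗ (p i *ₗ apply (E i) x)       ≈⟨ *ₗ-comm _ _ _ ⟩
      p i *ₗ (a *ₗ apply (E i) x)       ≈⟨ *ₗ-congˡ Ey≈aEx ⟨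
      p i *ₗ apply (E i) y              ∎

    subspace : IsSubspace W
    subspace = record
      { resp     = λ x≈y Wx i →
          ≈ᴹ-trans (*ₗ-congˡ (End.⟦⟧-cong (E i) (≈ᴹ-sym x≈y)))
          (≈ᴹ-trans (Wx i) (*ₗ-congˡ (End.⟦⟧-cong (E i) x≈y)))
      ; +-closed = λ Wx Wy i →
          ≈ᴹ-trans (*ₗ-congˡ (End.+ᴹ-homo (E i) _ _))
          (≈ᴹ-trans (*ₗ-distribˡ _ _ _)
          (≈ᴹ-trans (+ᴹ-cong (Wx i) (Wy i))
          (≈ᴹ-trans (≈ᴹ-sym (*ₗ-distribˡ _ _ _))
          (*ₗ-congˡ (≈ᴹ-sym (End.+ᴹ-homo (E i) _ _))))))
      ; ·-closed = λ a Wx i → scaled (End.*ₗ-homo (E i) a _) (Wx i)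
      }

    A-closed : ∀ {x} → W x → W (apply A x)
    A-closed Wx i = scaled (S.E∘A i _) (Wx i)

    w₀∈W : W (w 0)
    w₀∈W i = begin
      zᵢ i *ₗ apply (E i) (w 0)                         ≈⟨ Diagonal.component Z-diagonal i (w 0) ⟨
      apply (E i) (apply Z (w 0))                       ≈⟨ End.⟦⟧-cong (E i) Zw₀≈ ⟩
      apply (E i) (apply (cubicₑ α₀ α₁ α₂ α₃) (w 0))    ≈⟨ Diagonal.component (cubicₑ-diagonal α₀ α₁ α₂ α₃) i (w 0) ⟩
      p i *ₗ apply (E i) (w 0)                          ∎

  cubic-difference : ∀ α₀ α₁ α₂ α₃ →
    (∀ i → z (toℕ i) ≈ cubic commutativeRing α₀ α₁ α₂ α₃ (θ i)) →
    ∀ i j → toℕ j ≡ suc (toℕ i) →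
    cubic commutativeRing α₀ α₁ α₂ α₃ (θ i) - cubic commutativeRing α₀ α₁ α₂ α₃ (θ j)
    ≈ θ i * θ j * (θ i - θ j)
  cubic-difference α₀ α₁ α₂ α₃ z≈p i j adj =
    trans (+-cong (sym (z≈p i)) (-‿cong (sym (z≈p j)))) (z-difference i j adj)

  -- Both sides of [p(A) , `A*`] `w n` = `C` `w n` are compared at `w (3 + n)`. On the left `A*`
  -- acts at degree n in one term and at degree n + 3 in the other, each time with the factor `α₃`.
  eigenvalue*-recurrence : ∀ α₀ α₁ α₂ α₃ →
    (∀ i → z (toℕ i) ≈ cubic commutativeRing α₀ α₁ α₂ α₃ (θ i)) →
    ∀ n → 3 ℕ.+ n ≤ d →
    α₃ * (θ* (clamp d n) - θ* (clamp d (3 ℕ.+ n))) ≈ θ* (clamp d (1 ℕ.+ n)) - θ* (clamp d (2 ℕ.+ n))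
  eigenvalue*-recurrence α₀ α₁ α₂ α₃ z≈p n n≤d = begin
    α₃ * (a - e)
      ≈⟨ solve 6 (λ α₀ α₁ α₂ α₃ a e →
           let one = con (1 , 0)
               lower = α₀ :* con (0 , 0) :+ α₁ :* con (0 , 0) :+ α₂ :* con (0 , 0) in
           α₃ :* (a :- e) := (lower :+ α₃ :* (a :* one)) :+ (:- one) :* (e :* (lower :+ α₃ :* one)))
         refl α₀ α₁ α₂ α₃ a e ⟩
    (α₀ * 0# + α₁ * 0# + α₂ * 0# + α₃ * (a * 1#))
      + (- 1#) * (e * (α₀ * 0# + α₁ * 0# + α₂ * 0# + α₃ * 1#))
      ≈⟨ leading-unique n≤d (≈ᴹ-sym (C-commutator (cubicₑ-diagonal α₀ α₁ α₂ α₃) (cubic-difference α₀ α₁ α₂ α₃ z≈p) (w n)))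
           (leading-- (leading-cubicₑ α₀ α₁ α₂ α₃ (leading-A (leading-w n)))
                      (leading-A (leading-cubicₑ α₀ α₁ α₂ α₃ (leading-w n))))
           leading-C ⟩
    b * 1# + (- 1#) * (c′ * 1#)
      ≈⟨ solve 2 (λ b c → b :* con (1 , 0) :+ (:- con (1 , 0)) :* (c :* con (1 , 0)) := b :- c)
         refl b c′ ⟩
    b - c′ ∎
    where
    open SetoidReasoning setoid
    a = θ* (clamp d n)
    b = θ* (clamp d (1 ℕ.+ n))
    c′ = θ* (clamp d (2 ℕ.+ n))
    e = θ* (clamp d (3 ℕ.+ n))

  -- Choice of the scalars and the two TD relations.

  private
    f* : ℕ → Carrier
    f* n = θ* (clamp d n)

    *-vanishʳ : ∀ x {y} → y ≈ 0# → x * y ≈ 0#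
    *-vanishʳ x y≈0 = trans (*-congˡ y≈0) (zeroʳ x)

  isTD-<3 : ¬ 3 ≤ d → IsTD Φ
  -- No n satisfies 3 + n ≤ d, so both recurrences hold vacuously; `0#` is an arbitrary choice of β.
  isTD-<3 3≰d with recurrence⇒tdPolynomial commutativeRing θ 0# (λ n 3+n≤d → ⊥-elim (3≰d (ℕ.m+n≤o⇒m≤o 3 3+n≤d)))
             | recurrence⇒tdPolynomial commutativeRing θ* 0# (λ n 3+n≤d → ⊥-elim (3≰d (ℕ.m+n≤o⇒m≤o 3 3+n≤d)))
  ... | γ , ϱ , vanishes | γ* , ϱ* , vanishes* = tdPolynomials⇒TD 0# γ γ* ϱ ϱ*
    (λ i j adj → *-vanishʳ _ (vanishes i j adj)) (λ i j adj → *-vanishʳ _ (vanishes* i j adj))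

  -- The factor `ι - 1# + 1#` is left as β + 1 with β = ι - 1, the shape expected by
  -- `recurrence⇒tdPolynomial`.
  θ*-recurrence : ∀ {α₃ ι} → ι * α₃ ≈ 1# →
    (∀ n → 3 ℕ.+ n ≤ d → α₃ * (f* n - f* (3 ℕ.+ n)) ≈ f* (1 ℕ.+ n) - f* (2 ℕ.+ n)) →
    ∀ n → 3 ℕ.+ n ≤ d →
    f* n - f* (3 ℕ.+ n) ≈ (ι - 1# + 1#) * (f* (1 ℕ.+ n) - f* (2 ℕ.+ n))
  θ*-recurrence {α₃} {ι} ια₃≈1 α₃-recurrence n n≤d = begin
    x                              ≈⟨ *-identityˡ x ⟨
    1# * x                         ≈⟨ *-congʳ ια₃≈1 ⟨
    (ι * α₃) * x                   ≈⟨ solve 3 (λ ι α₃ x → let one = con (1 , 0) in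
                                        (ι :* α₃) :* x := (ι :- one :+ one) :* (α₃ :* x))
                                      refl ι α₃ x ⟩
    (ι - 1# + 1#) * (α₃ * x)       ≈⟨ *-congˡ (α₃-recurrence n n≤d) ⟩
    (ι - 1# + 1#) * (f* (1 ℕ.+ n) - f* (2 ℕ.+ n)) ∎
    where
    open SetoidReasoning setoid
    x : Carrier
    x = f* n - f* (3 ℕ.+ n)

  -- The right-hand side is a difference of distinct eigenvalues, hence a unit, and `α₃` divides it.
  -- The inverse is explicit, so `α₃` is never tested for being zero.
  α₃-invertible : 3 ≤ d → ∀ {α₃} → α₃ * (f* 0 - f* 3) ≈ f* 1 - f* 2 → ∃[ ι ] ι * α₃ ≈ 1#
  α₃-invertible 3≤d {α₃} α₃≈ with S*.θ-difference-invertible 1≢2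
    where
    1≢2 : clamp d 1 ≢ clamp d 2
    1≢2 eq with () ← ≡.trans (≡.sym (toℕ-clamp (ℕ.m+n≤o⇒n≤o 2 3≤d)))
                       (≡.trans (≡.cong toℕ eq) (toℕ-clamp (ℕ.m+n≤o⇒n≤o 1 3≤d)))
  ... | κ , inverse = κ * (f* 0 - f* 3) , (begin
    κ * (f* 0 - f* 3) * α₃    ≈⟨ *-assoc _ _ _ ⟩
    κ * ((f* 0 - f* 3) * α₃)  ≈⟨ *-congˡ (*-comm _ _) ⟩
    κ * (α₃ * (f* 0 - f* 3))  ≈⟨ *-congˡ α₃≈ ⟩
    κ * (f* 1 - f* 2)         ≈⟨ inverse ⟩
    1#                        ∎)
    where open SetoidReasoning setoid

  -- The value β = ι - 1 serves both relations: the first takes γ and ϱ from the coefficients of the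
  -- cubic, the second takes γ* and ϱ* from the recurrence for θ*.
  cubic⇒TD : ∀ α₀ α₁ α₂ α₃ ι → ι * α₃ ≈ 1# →
    (∀ i → z (toℕ i) ≈ cubic commutativeRing α₀ α₁ α₂ α₃ (θ i)) → IsTD Φ
  cubic⇒TD α₀ α₁ α₂ α₃ ι ια₃≈1 z≈p =
    let γ* , ϱ* , vanishes* = recurrence⇒tdPolynomial commutativeRing θ* (ι - 1#)
          (θ*-recurrence ια₃≈1 (eigenvalue*-recurrence α₀ α₁ α₂ α₃ z≈p))
    in tdPolynomials⇒TD (ι - 1#) (- (ι * α₂)) γ* (- (ι * α₁)) ϱ*
      (λ i j adj → cubic⇒tdPolynomial commutativeRing α₀ α₁ α₂ α₃ ι ια₃≈1 (θ i) (θ j)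
        (cubic-difference α₀ α₁ α₂ α₃ z≈p i j adj))
      (λ i j adj → *-vanishʳ _ (vanishes* i j adj))

  isTD-≥3 : 3 ≤ d → IsTD Φ
  isTD-≥3 3≤d =
    let α₀ , α₁ , α₂ , α₃ , Zw₀≈ = Zw₀-cubic 3≤d
        z≈p                      = z-cubic α₀ α₁ α₂ α₃ Zw₀≈
        -- The instance n = 0 of the recurrence already forces `α₃` to be a unit.
        ι , ια₃≈1                = α₃-invertible 3≤d (eigenvalue*-recurrence α₀ α₁ α₂ α₃ z≈p 0 3≤d)
    in cubic⇒TD α₀ α₁ α₂ α₃ ι ια₃≈1 z≈p

mainTheorem4 : ∀ {c ℓ m ℓm} (d : ℕ) → 2 ≤ d →
    (F : Field c ℓ) (V : VectorSpace F m ℓm) → HasDimension V (suc d) →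
    (Φ : HessenbergSystem V d) → IsTridiagonal Φ → IsTD Φ
-- The cubic argument compares components at index 3, which exists only for d ≥ 3.
mainTheorem4 d _ F V _ Φ tridiagonal with 3 ℕ.≤? d
... | yes 3≤d = TridiagonalHessenberg.isTD-≥3 Φ tridiagonal 3≤d
... | no  3≰d = TridiagonalHessenberg.isTD-<3 Φ tridiagonal 3≰d
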